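{- Suppose that $k\ge 2$ and $\mathbf h\in\mathbb Z^k\setminus\{\mathbf 0\}$. Then, for each $\varepsilon>0$, one has $$U_{2t,k}(P;\mathbf h)\ll P^{t-1+\varepsilon}\quad (1\le t\le k)$$ for positive integers $P$, where the implied constant depends at most on $k$ and $\varepsilon$.
   Context: For natural numbers $s,k$, a positive integer $P$, and $\mathbf h=(h_1,\ldots,h_k)\in\mathbb Z^k$, $U_{s,k}(P;\mathbf h)$ denotes the number of integer tuples $(x_1,\ldots,x_s)$ with $|x_i|\le P$ $(1\le i\le s)$ satisfying $$\sum_{i=1}^s x_i^{2j-1}=h_j\quad (1\le j\le k).$$ Here $t$ is an integer. -}

module Defs where

open import Data.Fin.Base using (Fin; toℕ)
open import Data.Fin.Properties using (all?)
open import Data.Integer.Base as ℤ using (ℤ; +_; -[1+_]; 0ℤ; ∣_∣)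
open import Data.Integer.Properties using (_≟_; +-injective; -[1+-injective)
open import Data.List.Base as List using (List; []; _∷_; _++_; upTo; filter; length; cartesianProductWith)
open import Data.List.Relation.Binary.Disjoint.Propositional using (Disjoint)
open import Data.List.Membership.Propositional using (_∈_)
open import Data.List.Membership.Propositional.Properties
  using (∈-++⁺ˡ; ∈-++⁺ʳ; ∈-++⁻; ∈-map⁺; ∈-map⁻; ∈-upTo⁺; ∈-upTo⁻; ∈-cartesianProductWith⁺; ∈-cartesianProductWith⁻)
open import Data.List.Relation.Unary.Any using (here)
open import Data.List.Relation.Unary.All using ([])
open import Data.List.Relation.Unary.AllPairs using ([]; _∷_)
open import Data.List.Relation.Unary.Unique.Propositional using (Unique)
import Data.List.Relation.Unary.Unique.Propositional.Properties as Unique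
open import Data.Nat.Base as ℕ using (ℕ; zero; suc; s≤s)
open import Data.Product.Base using (_,_)
open import Data.Rational.Unnormalised.Base using (ℚᵘ; ↥_; ↧ₙ_)
open import Data.Sum.Base using (inj₁; inj₂)
open import Data.Vec.Base as Vec using (Vec; []; _∷_; foldr′; lookup)
open import Data.Vec.Properties using (∷-injective)
open import Data.Vec.Relation.Unary.All using (All; []; _∷_)
open import Relation.Binary.PropositionalEquality using (_≡_; refl)
open import Relation.Nullary.Decidable using (Dec)

powerSum : ∀ {s} → ℕ → Vec ℤ s → ℤ
powerSum n xs = foldr′ ℤ._+_ 0ℤ (Vec.map (ℤ._^ n) xs)

-- The component h_j (1 ≤ j ≤ k) is lookup h i with j = suc (toℕ i).
Solves : ∀ {s k} → Vec ℤ k → Vec ℤ s → Set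
Solves {k = k} h xs =
  ∀ (i : Fin k) → powerSum (2 ℕ.* suc (toℕ i) ℕ.∸ 1) xs ≡ lookup h i

solves? : ∀ {s k} (h : Vec ℤ k) (xs : Vec ℤ s) → Dec (Solves h xs)
solves? h xs = all? λ i → powerSum (2 ℕ.* suc (toℕ i) ℕ.∸ 1) xs ≟ lookup h i

interval : ℕ → List ℤ
interval P = List.map +_ (upTo (suc P)) ++ List.map -[1+_] (upTo P)

-- All integer s-tuples with every |x_i| ≤ P, each listed exactly once
-- (see ∈-box⁺, ∈-box⁻ and box-unique below).
box : ∀ s → ℕ → List (Vec ℤ s)
box zero    P = [] ∷ []
box (suc s) P = cartesianProductWith _∷_ (interval P) (box s P)

U : ∀ s k → ℕ → Vec ℤ k → ℕ
U s k P h = length (filter (solves? h) (box s P))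

-- u ≤ C · P ^ e  means the real inequality u ≤ C P^e for the rational
-- exponent e = a / d, with both sides raised to the d-th power; when a < 0
-- the factor P^a is moved to the left (so P ≥ 1 is intended in that case).
infix 4 _≤_·_^_
_≤_·_^_ : ℕ → ℕ → ℕ → ℚᵘ → Set
u ≤ C · P ^ e with ↥ e
... | + a      = u ℕ.^ ↧ₙ e ℕ.≤ C ℕ.^ ↧ₙ e ℕ.* P ℕ.^ a
... | -[1+ a ] = u ℕ.^ ↧ₙ e ℕ.* P ℕ.^ suc a ℕ.≤ C ℕ.^ ↧ₙ e

∈-interval⁺ : ∀ {P} x → ∣ x ∣ ℕ.≤ P → x ∈ interval P
∈-interval⁺     (+ n)    n≤P = ∈-++⁺ˡ (∈-map⁺ +_ (∈-upTo⁺ (s≤s n≤P)))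
∈-interval⁺ {P} -[1+ n ] n<P =
  ∈-++⁺ʳ (List.map +_ (upTo (suc P))) (∈-map⁺ -[1+_] (∈-upTo⁺ n<P))

∈-interval⁻ : ∀ {P} x → x ∈ interval P → ∣ x ∣ ℕ.≤ P
∈-interval⁻ {P} x x∈ with ∈-++⁻ (List.map +_ (upTo (suc P))) x∈
... | inj₁ p with n , n∈ , refl ← ∈-map⁻ +_ p     = ℕ.s≤s⁻¹ (∈-upTo⁻ n∈)
... | inj₂ p with n , n∈ , refl ← ∈-map⁻ -[1+_] p = ∈-upTo⁻ n∈

interval-unique : ∀ P → Unique (interval P)
interval-unique P = Unique.++⁺
  (Unique.map⁺ +-injective (Unique.upTo⁺ (suc P)))
  (Unique.map⁺ -[1+-injective (Unique.upTo⁺ P))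
  disjoint
  where
  disjoint : Disjoint (List.map +_ (upTo (suc P))) (List.map -[1+_] (upTo P))
  disjoint (p , q) with ∈-map⁻ +_ p | ∈-map⁻ -[1+_] q
  ... | _ , _ , refl | _ , _ , ()

∈-box⁺ : ∀ {s P} {xs : Vec ℤ s} → All (λ x → ∣ x ∣ ℕ.≤ P) xs → xs ∈ box s P
∈-box⁺ []       = here refl
∈-box⁺ (p ∷ ps) = ∈-cartesianProductWith⁺ _∷_ (∈-interval⁺ _ p) (∈-box⁺ ps)

∈-box⁻ : ∀ {s P} {xs : Vec ℤ s} → xs ∈ box s P → All (λ x → ∣ x ∣ ℕ.≤ P) xs
∈-box⁻ {zero}  {P} {[]} _  = []
∈-box⁻ {suc s} {P} xs∈
  with y , ys , y∈ , ys∈ , refl ← ∈-cartesianProductWith⁻ _∷_ (interval P) (box s P) xs∈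
  = ∈-interval⁻ y y∈ ∷ ∈-box⁻ ys∈

box-unique : ∀ s P → Unique (box s P)
box-unique zero    P = [] ∷ []
box-unique (suc s) P =
  Unique.cartesianProductWith⁺ _∷_ ∷-injective (interval-unique P) (box-unique s P)

{-# OPTIONS --safe #-}

-- Let t ≤ k.  In a solution in 2t variables, first cancel a pair x, −x if there is one; this costs a
-- factor O(P) and reduces t by one, and since h ≠ 0 it cannot go on down to t = 0.  If there is no
-- such pair and t ≥ 2, fix t − 1 of the variables (0 among them, if it occurs).  For two completions
-- v and y by t + 1 variables the power sums of exponents 1, 3, …, 2t − 1 agree, so Newton's identities
-- give Π(X+v)·Π(X−y) − Π(X−v)·Π(X+y) = cX for some constant c.  Evaluating at the entries of v and y
-- shows that either every entry of v occurs in y, or Π_{i<j} (v_i+v_j)² = Π_{i<j} (y_i+y_j)² ≠ 0.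
-- In the second case every v_i + v_j divides a fixed nonzero integer of size P^O(1), so the divisor
-- bound leaves O(P^ε) choices for v.  For t = 1 the equations of degree 1 and 3 determine {x₁, x₂}.
--
-- Counting is done with supports: a set of tuples is covered by a list of supports when the entries
-- of each tuple lie in one of them, which ignores the order of the variables and costs only
-- (length of the support)^(2t) in the end.
module Submission where

open import Defs
open import Data.Fin.Base using (Fin; toℕ; fromℕ<)
open import Data.Fin.Properties using (all?; toℕ-fromℕ<)
open import Data.Integer.Base as ℤ using (ℤ; +_; -[1+_]; 0ℤ; 1ℤ; ∣_∣)
import Data.Integer.Properties as ℤ
import Algebra.Properties.AbelianGroup ℤ.+-0-abelianGroup as ℤ+
import Data.Integer.Tactic.RingSolver as ℤSolver
open import Data.List.Base as List using
  (List; []; _∷_; [_]; _++_; length; map; take; drop; upTo; concatMap; cartesianProductWith; filter)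
open import Data.List.Properties using
  (length-++; length-map; length-take; length-drop; length-upTo; take++drop≡id)
open import Data.List.Membership.Propositional using (_∈_; _∉_; find; lose)
open import Data.List.Membership.Propositional.Properties using
  ( ∈-++⁺ˡ; ∈-++⁺ʳ; ∈-++⁻; ∈-map⁺; ∈-map⁻; ∈-filter⁻; ∈-concatMap⁺
  ; ∈-cartesianProductWith⁺; ∈-cartesianProductWith⁻; ∈-∃++)
open import Data.List.Relation.Binary.Permutation.Propositional as ↭ using
  (_↭_; refl; prep; swap; ↭-trans; ↭⇒↭ₛ)
open import Data.List.Relation.Binary.Permutation.Propositional.Properties using
  (shift; ↭-length; All-resp-↭; ∈-resp-↭)
import Data.List.Relation.Binary.Permutation.Setoid.Properties as ↭ₛ
open import Data.List.Relation.Binary.Subset.Propositional using (_⊆_)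
open import Data.List.Relation.Unary.All as All using (All; []; _∷_)
import Data.List.Relation.Unary.All.Properties as All
open import Data.List.Relation.Unary.AllPairs as AllPairs using (AllPairs; []; _∷_)
open import Data.List.Relation.Unary.Any as Any using (here; there)
open import Data.List.Relation.Unary.Unique.Propositional using (Unique)
import Data.List.Relation.Unary.Unique.Propositional.Properties as Unique
open import Data.Nat.Base as ℕ using
  ( ℕ; zero; suc; _≤_; _<_; _*_; _^_; _∸_; _%_; ⌊_/2⌋; NonZero; NonTrivial; z≤n; s≤s; s<s)
import Data.Nat.Properties as ℕ
open import Data.Nat.Coprimality using (Coprime; coprime-divisor)
open import Data.Nat.Divisibility using
  ( _∣_; _∤_; _∣?_; divides; ∣-trans; ∣1⇒≡1; ∣n⇒∣m*n; m∣m*n; n∣m*n; *-cancelˡ-∣)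
open import Data.Nat.DivMod using (m≡m%n+[m/n]*n; m%n<n)
open import Data.Nat.Induction using (<-rec)
open import Data.Nat.ListAction using (product)
open import Data.Nat.Primality using
  ( Prime; _Rough_; 2-rough; ∤⇒rough-suc; rough⇒≤; rough∧∣⇒rough; rough∧∣⇒prime
  ; prime⇒irreducible; prime⇒nonTrivial; prime⇒nonZero)
open import Data.Nat.Primality.Factorisation using (factorise; module PrimeFactorisation)
open import Data.Nat.Tactic.RingSolver using (solve-∀)
open import Data.Product.Base using (∃-syntax; _×_; _,_; proj₁; proj₂)
open import Data.Rational.Unnormalised.Base as ℚᵘ using (ℚᵘ; mkℚᵘ; 0ℚᵘ; 1ℚᵘ; _/_; ↥_; ↧ₙ_; *<*)
open import Data.Sum.Base using (_⊎_; inj₁; inj₂; [_,_]′)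
open import Data.Vec.Base as Vec using (Vec; lookup; replicate)
import Data.Vec.Properties as Vec
import Data.Vec.Relation.Unary.All.Properties as Vec
open import Function.Base using (_∘_)
open import Relation.Binary.PropositionalEquality hiding ([_])
open import Relation.Nullary using (¬_; Dec; yes; no; contradiction; ¬?; _×-dec_)
open import Relation.Nullary.Decidable using (map′)

-- Newton's identities

p : ℕ → List ℤ → ℤ
p r []       = 0ℤ
p r (x ∷ xs) = x ℤ.^ r ℤ.+ p r xs

e : List ℤ → ℕ → ℤ
e xs       zero    = 1ℤ
e []       (suc m) = 0ℤ
e (x ∷ xs) (suc m) = e xs (suc m) ℤ.+ x ℤ.* e xs m

-- hook m r xs is the sum of x_i ^ r * e_m(xs without x_i) over all indices i.
hook : ℕ → ℕ → List ℤ → ℤ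
hook m       r []       = 0ℤ
hook zero    r (x ∷ xs) = x ℤ.^ r ℤ.+ hook zero r xs
hook (suc m) r (x ∷ xs) =
  x ℤ.^ r ℤ.* e xs (suc m) ℤ.+ (hook (suc m) r xs ℤ.+ x ℤ.* hook m r xs)

hook-zero : ∀ r xs → hook 0 r xs ≡ p r xs
hook-zero r []       = refl
hook-zero r (x ∷ xs) = cong (λ a → x ℤ.^ r ℤ.+ a) (hook-zero r xs)

-- Expand the product over an index i and a set T of m+1 indices. Terms with i outside T make up
-- `hook (suc m) r`; if i lies in T, its factor x_i joins x_i^r and the term belongs to
-- `hook m (suc r)`.
p*e : ∀ m r xs → p r xs ℤ.* e xs (suc m) ≡ hook (suc m) r xs ℤ.+ hook m (suc r) xs
p*e m r [] = refl
p*e zero r (x ∷ xs) = begin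
  (X ℤ.+ P) ℤ.* (E ℤ.+ x ℤ.* 1ℤ)
    ≡⟨ expand X P E x ⟩
  X ℤ.* E ℤ.+ x ℤ.* X ℤ.+ P ℤ.* E ℤ.+ x ℤ.* P
    ≡⟨ cong₂ (λ a b → X ℤ.* E ℤ.+ x ℤ.* X ℤ.+ a ℤ.+ x ℤ.* b)
             (p*e 0 r xs) (sym (hook-zero r xs)) ⟩
  X ℤ.* E ℤ.+ x ℤ.* X ℤ.+ (hook 1 r xs ℤ.+ hook 0 (suc r) xs) ℤ.+ x ℤ.* hook 0 r xs
    ≡⟨ collect (X ℤ.* E) (x ℤ.* X) (hook 1 r xs) (hook 0 (suc r) xs) (x ℤ.* hook 0 r xs) ⟩
  X ℤ.* E ℤ.+ (hook 1 r xs ℤ.+ x ℤ.* hook 0 r xs) ℤ.+ (x ℤ.* X ℤ.+ hook 0 (suc r) xs) ∎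
  where
  open ≡-Reasoning
  X = x ℤ.^ r
  P = p r xs
  E = e xs 1
  expand : ∀ X P E x → (X ℤ.+ P) ℤ.* (E ℤ.+ x ℤ.* 1ℤ) ≡
    X ℤ.* E ℤ.+ x ℤ.* X ℤ.+ P ℤ.* E ℤ.+ x ℤ.* P
  expand = ℤSolver.solve-∀
  collect : ∀ a b c d f → a ℤ.+ b ℤ.+ (c ℤ.+ d) ℤ.+ f ≡ a ℤ.+ (c ℤ.+ f) ℤ.+ (b ℤ.+ d)
  collect = ℤSolver.solve-∀
p*e (suc m) r (x ∷ xs) = begin
  (X ℤ.+ P) ℤ.* (E ℤ.+ x ℤ.* E′)
    ≡⟨ expand X P E E′ x ⟩
  X ℤ.* E ℤ.+ x ℤ.* X ℤ.* E′ ℤ.+ P ℤ.* E ℤ.+ x ℤ.* (P ℤ.* E′)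
    ≡⟨ cong₂ (λ a b → X ℤ.* E ℤ.+ x ℤ.* X ℤ.* E′ ℤ.+ a ℤ.+ x ℤ.* b)
             (p*e (suc m) r xs) (p*e m r xs) ⟩
  X ℤ.* E ℤ.+ x ℤ.* X ℤ.* E′ ℤ.+ (hook (suc (suc m)) r xs ℤ.+ hook (suc m) (suc r) xs)
    ℤ.+ x ℤ.* (hook (suc m) r xs ℤ.+ hook m (suc r) xs)
    ≡⟨ collect (X ℤ.* E) (x ℤ.* X ℤ.* E′) (hook (suc (suc m)) r xs)
         (hook (suc m) (suc r) xs) x (hook (suc m) r xs) (hook m (suc r) xs) ⟩
  X ℤ.* E ℤ.+ (hook (suc (suc m)) r xs ℤ.+ x ℤ.* hook (suc m) r xs)
    ℤ.+ (x ℤ.* X ℤ.* E′ ℤ.+ (hook (suc m) (suc r) xs ℤ.+ x ℤ.* hook m (suc r) xs)) ∎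
  where
  open ≡-Reasoning
  X = x ℤ.^ r
  P = p r xs
  E = e xs (suc (suc m))
  E′ = e xs (suc m)
  expand : ∀ X P E E′ x → (X ℤ.+ P) ℤ.* (E ℤ.+ x ℤ.* E′) ≡
    X ℤ.* E ℤ.+ x ℤ.* X ℤ.* E′ ℤ.+ P ℤ.* E ℤ.+ x ℤ.* (P ℤ.* E′)
  expand = ℤSolver.solve-∀
  collect : ∀ a b c d x f g → a ℤ.+ b ℤ.+ (c ℤ.+ d) ℤ.+ x ℤ.* (f ℤ.+ g) ≡
    a ℤ.+ (c ℤ.+ x ℤ.* f) ℤ.+ (b ℤ.+ (d ℤ.+ x ℤ.* g))
  collect = ℤSolver.solve-∀

-- Each monomial of `e xs (suc m)` arises m+1 times, once for each of its variables singled out as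
-- x_i.
hook-one : ∀ m xs → hook m 1 xs ≡ + suc m ℤ.* e xs (suc m)
hook-one m [] = sym (ℤ.*-zeroʳ (+ suc m))
hook-one zero (x ∷ xs) = trans (cong (λ a → x ℤ.* 1ℤ ℤ.+ a) (hook-one 0 xs)) (lemma x (e xs 1))
  where
  lemma : ∀ x a → x ℤ.* 1ℤ ℤ.+ 1ℤ ℤ.* a ≡ 1ℤ ℤ.* (a ℤ.+ x ℤ.* 1ℤ)
  lemma = ℤSolver.solve-∀
hook-one (suc m) (x ∷ xs) = begin
  x ℤ.* 1ℤ ℤ.* E′ ℤ.+ (hook (suc m) 1 xs ℤ.+ x ℤ.* hook m 1 xs)
    ≡⟨ cong₂ (λ a b → x ℤ.* 1ℤ ℤ.* E′ ℤ.+ (a ℤ.+ x ℤ.* b)) (hook-one (suc m) xs) (hook-one m xs) ⟩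
  x ℤ.* 1ℤ ℤ.* E′ ℤ.+ ((1ℤ ℤ.+ M) ℤ.* E ℤ.+ x ℤ.* (M ℤ.* E′))
    ≡⟨ lemma x E E′ M ⟩
  (1ℤ ℤ.+ M) ℤ.* (E ℤ.+ x ℤ.* E′) ∎
  where
  open ≡-Reasoning
  E = e xs (suc (suc m))
  E′ = e xs (suc m)
  M = + suc m
  lemma : ∀ x E E′ M → x ℤ.* 1ℤ ℤ.* E′ ℤ.+ ((1ℤ ℤ.+ M) ℤ.* E ℤ.+ x ℤ.* (M ℤ.* E′)) ≡
    (1ℤ ℤ.+ M) ℤ.* (E ℤ.+ x ℤ.* E′)
  lemma = ℤSolver.solve-∀

-- Newton's identities, unrolled: (m+1) e_{m+1} = hook m 1, and p*e trades
-- hook (i+1) j for hook i (j+1), down to hook 0 (m+1) = p (m+1).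
e-determined : ∀ M xs ys → (∀ r → 1 ≤ r → r ≤ M → p r xs ≡ p r ys) →
  ∀ m → m ≤ M → e xs m ≡ e ys m
e-determined M xs ys p≡ = <-rec (λ m → m ≤ M → e xs m ≡ e ys m) step
  where
  step : ∀ m → (∀ {m′} → m′ < m → m′ ≤ M → e xs m′ ≡ e ys m′) → m ≤ M → e xs m ≡ e ys m
  step zero    rec m≤M = refl
  step (suc m) rec m≤M = ℤ.*-cancelˡ-≡ (+ suc m) (e xs (suc m)) (e ys (suc m))
    (trans (sym (hook-one m xs)) (trans (hook≡ m 1 (s≤s z≤n) (ℕ.+-comm m 1)) (hook-one m ys)))
    where
    hook≡ : ∀ i j → 1 ≤ j → i ℕ.+ j ≡ suc m → hook i j xs ≡ hook i j ys
    hook≡ zero j 1≤j refl =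
      trans (hook-zero j xs) (trans (p≡ j 1≤j m≤M) (sym (hook-zero j ys)))
    hook≡ (suc i) j 1≤j i+j≡ = ℤ+.∙-cancelʳ (hook i (suc j) xs) _ _ (begin
      hook (suc i) j xs ℤ.+ hook i (suc j) xs ≡⟨ p*e i j xs ⟨
      p j xs ℤ.* e xs (suc i)                 ≡⟨ cong₂ ℤ._*_ (p≡ j 1≤j j≤M) (rec i<m (ℕ.≤-trans (ℕ.<⇒≤ i<m) m≤M)) ⟩
      p j ys ℤ.* e ys (suc i)                 ≡⟨ p*e i j ys ⟩
      hook (suc i) j ys ℤ.+ hook i (suc j) ys ≡⟨ cong (λ a → hook (suc i) j ys ℤ.+ a)
        (hook≡ i (suc j) (s≤s z≤n) (trans (ℕ.+-suc i j) i+j≡)) ⟨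
      hook (suc i) j ys ℤ.+ hook i (suc j) xs ∎)
      where
      open ≡-Reasoning
      i<m : suc i < suc m
      i<m = subst (suc i <_) i+j≡ (ℕ.m<m+n (suc i) 1≤j)
      j≤M : j ≤ M
      j≤M = ℕ.≤-trans (subst (j ≤_) i+j≡ (ℕ.m≤n+m j (suc i))) m≤M

-- Products of linear factors as polynomials in X

lin : ℤ → List ℤ → ℤ
lin X []       = 1ℤ
lin X (x ∷ xs) = (X ℤ.+ x) ℤ.* lin X xs

-- Horner evaluation of the sum of e_i X^(m-i) over i ≤ m, the leading part of Π(X+x). It depends on
-- e_0, ..., e_m only, so two lists can be compared as soon as these agree.
horner : ℤ → List ℤ → ℕ → ℤ
horner X xs zero    = 1ℤ
horner X xs (suc m) = X ℤ.* horner X xs m ℤ.+ e xs (suc m)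

horner-∷ : ∀ X x xs m →
  horner X (x ∷ xs) (suc m) ≡ horner X xs (suc m) ℤ.+ x ℤ.* horner X xs m
horner-∷ X x xs zero    = sym (ℤ.+-assoc (X ℤ.* 1ℤ) (e xs 1) (x ℤ.* 1ℤ))
horner-∷ X x xs (suc m) =
  trans (cong (λ a → X ℤ.* a ℤ.+ e (x ∷ xs) (suc (suc m))) (horner-∷ X x xs m))
        (lemma X x (horner X xs m) (e xs (suc m)) (e xs (suc (suc m))))
  where
  lemma : ∀ X x H E E′ → X ℤ.* (X ℤ.* H ℤ.+ E ℤ.+ x ℤ.* H) ℤ.+ (E′ ℤ.+ x ℤ.* E) ≡
    X ℤ.* (X ℤ.* H ℤ.+ E) ℤ.+ E′ ℤ.+ x ℤ.* (X ℤ.* H ℤ.+ E)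
  lemma = ℤSolver.solve-∀

e-vanish : ∀ xs m → length xs < m → e xs m ≡ 0ℤ
e-vanish []       (suc m) _       = refl
e-vanish (x ∷ xs) (suc m) (s<s l) = trans
  (cong₂ (λ a b → a ℤ.+ x ℤ.* b) (e-vanish xs (suc m) (ℕ.m<n⇒m<1+n l)) (e-vanish xs m l))
  (trans (ℤ.+-identityˡ (x ℤ.* 0ℤ)) (ℤ.*-zeroʳ x))

lin≡horner : ∀ X xs → lin X xs ≡ horner X xs (length xs)
lin≡horner X []       = refl
lin≡horner X (x ∷ xs) = begin
  (X ℤ.+ x) ℤ.* lin X xs                      ≡⟨ cong ((X ℤ.+ x) ℤ.*_) (lin≡horner X xs) ⟩
  (X ℤ.+ x) ℤ.* H                             ≡⟨ lemma X x H ⟩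
  X ℤ.* H ℤ.+ 0ℤ ℤ.+ x ℤ.* H                  ≡⟨ cong (λ a → X ℤ.* H ℤ.+ a ℤ.+ x ℤ.* H)
                                                   (e-vanish xs (suc (length xs)) ℕ.≤-refl) ⟨
  horner X xs (suc (length xs)) ℤ.+ x ℤ.* H   ≡⟨ horner-∷ X x xs (length xs) ⟨
  horner X (x ∷ xs) (suc (length xs))         ∎
  where
  open ≡-Reasoning
  H = horner X xs (length xs)
  lemma : ∀ X x H → (X ℤ.+ x) ℤ.* H ≡ X ℤ.* H ℤ.+ 0ℤ ℤ.+ x ℤ.* H
  lemma = ℤSolver.solve-∀

horner-cong : ∀ X xs ys m → (∀ i → i ≤ m → e xs i ≡ e ys i) → horner X xs m ≡ horner X ys m
horner-cong X xs ys zero    e≡ = refl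
horner-cong X xs ys (suc m) e≡ = cong₂ (λ a b → X ℤ.* a ℤ.+ b)
  (horner-cong X xs ys m λ i i≤m → e≡ i (ℕ.m≤n⇒m≤1+n i≤m)) (e≡ (suc m) ℕ.≤-refl)

-- By `e-determined` the coefficients e_0, ..., e_M coincide, so the two polynomials of degree M+2
-- differ at most in the coefficients of X and of 1. The latter is expressed by the values at 0,
-- which can be computed directly.
lin-difference : ∀ M xs ys → length xs ≡ suc (suc M) → length ys ≡ suc (suc M) →
  (∀ r → 1 ≤ r → r ≤ M → p r xs ≡ p r ys) →
  ∃[ c ] (∀ X → lin X xs ℤ.- lin X ys ≡ X ℤ.* c ℤ.+ (lin 0ℤ xs ℤ.- lin 0ℤ ys))
lin-difference M xs ys |xs| |ys| p≡ = c , λ X → trans (affine X)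
  (cong (λ a → X ℤ.* c ℤ.+ a) (sym (trans (affine 0ℤ) (ℤ.+-identityˡ c₀))))
  where
  c  = e xs (suc M) ℤ.- e ys (suc M)
  c₀ = e xs (suc (suc M)) ℤ.- e ys (suc (suc M))
  lemma : ∀ X H E E′ F F′ → X ℤ.* (X ℤ.* H ℤ.+ E) ℤ.+ E′ ℤ.- (X ℤ.* (X ℤ.* H ℤ.+ F) ℤ.+ F′) ≡
    X ℤ.* (E ℤ.- F) ℤ.+ (E′ ℤ.- F′)
  lemma = ℤSolver.solve-∀
  affine : ∀ X → lin X xs ℤ.- lin X ys ≡ X ℤ.* c ℤ.+ c₀
  affine X = begin
    lin X xs ℤ.- lin X ys
      ≡⟨ cong₂ ℤ._-_ (trans (lin≡horner X xs) (cong (horner X xs) |xs|))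
                     (trans (lin≡horner X ys) (cong (horner X ys) |ys|)) ⟩
    horner X xs (suc (suc M)) ℤ.- horner X ys (suc (suc M))
      ≡⟨ cong (λ a → horner X xs (suc (suc M)) ℤ.- (X ℤ.* (X ℤ.* a ℤ.+ e ys (suc M)) ℤ.+ e ys (suc (suc M))))
           (horner-cong X xs ys M (e-determined M xs ys p≡)) ⟨
    _
      ≡⟨ lemma X (horner X xs M) (e xs (suc M)) (e xs (suc (suc M))) (e ys (suc M)) (e ys (suc (suc M))) ⟩
    X ℤ.* c ℤ.+ c₀ ∎
    where open ≡-Reasoning

-- Sign changes and lists with equal odd power sums

neg : List ℤ → List ℤ
neg = map (λ x → ℤ.- x)

p-++ : ∀ r xs ys → p r (xs ++ ys) ≡ p r xs ℤ.+ p r ys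
p-++ r []       ys = sym (ℤ.+-identityˡ (p r ys))
p-++ r (x ∷ xs) ys = trans (cong (λ a → x ℤ.^ r ℤ.+ a) (p-++ r xs ys))
  (sym (ℤ.+-assoc (x ℤ.^ r) (p r xs) (p r ys)))

lin-++ : ∀ X xs ys → lin X (xs ++ ys) ≡ lin X xs ℤ.* lin X ys
lin-++ X []       ys = sym (ℤ.*-identityˡ (lin X ys))
lin-++ X (x ∷ xs) ys = trans (cong (λ a → (X ℤ.+ x) ℤ.* a) (lin-++ X xs ys))
  (sym (ℤ.*-assoc (X ℤ.+ x) (lin X xs) (lin X ys)))

-- Parity is encoded as the behaviour of r-th powers under a change of sign, the form that applies
-- directly to power sums.
Even : ℕ → Set
Even r = ∀ x → (ℤ.- x) ℤ.^ r ≡ x ℤ.^ r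

Odd : ℕ → Set
Odd r = ∀ x → (ℤ.- x) ℤ.^ r ≡ ℤ.- (x ℤ.^ r)

odd-suc : ∀ {r} → Even r → Odd (suc r)
odd-suc {r} ev x = trans (cong (λ a → ℤ.- x ℤ.* a) (ev x)) (sym (ℤ.neg-distribˡ-* x (x ℤ.^ r)))

even-suc : ∀ {r} → Odd r → Even (suc r)
even-suc {r} od x = trans (cong (λ a → ℤ.- x ℤ.* a) (od x)) (lemma x (x ℤ.^ r))
  where
  lemma : ∀ x a → ℤ.- x ℤ.* ℤ.- a ≡ x ℤ.* a
  lemma = ℤSolver.solve-∀

odd-power : ∀ j → Odd (suc (2 * j))
odd-power zero    = odd-suc {0} λ _ → refl
odd-power (suc j) = subst (λ n → Odd (suc n)) (sym (ℕ.*-suc 2 j))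
  (odd-suc {suc (suc (2 * j))} (even-suc {suc (2 * j)} (odd-power j)))

parity : ∀ r → Even r ⊎ ∃[ j ] r ≡ suc (2 * j)
parity zero = inj₁ λ _ → refl
parity (suc zero) = inj₂ (0 , refl)
parity (suc (suc r)) with parity r
... | inj₁ ev = inj₁ (even-suc {suc r} (odd-suc {r} ev))
... | inj₂ (j , r≡) = inj₂ (suc j , cong suc (trans (cong suc r≡) (sym (ℕ.*-suc 2 j))))

p-neg-even : ∀ {r} → Even r → ∀ xs → p r (neg xs) ≡ p r xs
p-neg-even ev []       = refl
p-neg-even ev (x ∷ xs) = cong₂ ℤ._+_ (ev x) (p-neg-even ev xs)

p-neg-odd : ∀ {r} → Odd r → ∀ xs → p r (neg xs) ≡ ℤ.- p r xs
p-neg-odd od []           = refl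
p-neg-odd {r} od (x ∷ xs) =
  trans (cong₂ ℤ._+_ (od x) (p-neg-odd {r} od xs)) (sym (ℤ.neg-distrib-+ (x ℤ.^ r) (p r xs)))

lin-zero-neg : ∀ xs → lin 0ℤ (neg xs) ≡ (ℤ.- 1ℤ) ℤ.^ length xs ℤ.* lin 0ℤ xs
lin-zero-neg []       = refl
lin-zero-neg (x ∷ xs) = trans (cong (λ a → (0ℤ ℤ.+ ℤ.- x) ℤ.* a) (lin-zero-neg xs))
  (lemma x ((ℤ.- 1ℤ) ℤ.^ length xs) (lin 0ℤ xs))
  where
  lemma : ∀ x s l → (0ℤ ℤ.+ ℤ.- x) ℤ.* (s ℤ.* l) ≡ (ℤ.- 1ℤ) ℤ.* s ℤ.* ((0ℤ ℤ.+ x) ℤ.* l)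
  lemma = ℤSolver.solve-∀

-- Apply `lin-difference` with M = 2t to `v ++ neg y` and `neg v ++ y`, both of length 2t+2. Even
-- power sums do not see the signs; odd ones vanish on both sides by hypothesis. The constant terms
-- agree, both being (-1)^(t+1) times the product of all entries of v and y.
odd-power-sums⇒affine : ∀ t v y → length v ≡ suc t → length y ≡ suc t →
  (∀ j → j < t → p (suc (2 * j)) v ≡ p (suc (2 * j)) y) →
  ∃[ c ] (∀ X → lin X v ℤ.* lin X (neg y) ℤ.- lin X (neg v) ℤ.* lin X y ≡ X ℤ.* c)
odd-power-sums⇒affine t v y |v| |y| p≡ =
  c , λ X → begin
    lin X v ℤ.* lin X (neg y) ℤ.- lin X (neg v) ℤ.* lin X y
      ≡⟨ cong₂ ℤ._-_ (lin-++ X v (neg y)) (lin-++ X (neg v) y) ⟨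
    lin X (v ++ neg y) ℤ.- lin X (neg v ++ y)
      ≡⟨ affine X ⟩
    X ℤ.* c ℤ.+ (lin 0ℤ (v ++ neg y) ℤ.- lin 0ℤ (neg v ++ y))
      ≡⟨ cong (λ a → X ℤ.* c ℤ.+ a) constant ⟩
    X ℤ.* c ℤ.+ 0ℤ
      ≡⟨ ℤ.+-identityʳ (X ℤ.* c) ⟩
    X ℤ.* c ∎
  where
  open ≡-Reasoning

  length≡ : ∀ xs ys → length xs ≡ suc t → length ys ≡ suc t → length (xs ++ ys) ≡ suc (suc (2 * t))
  length≡ xs ys |xs| |ys| = trans (length-++ xs) (trans (cong₂ ℕ._+_ |xs| |ys|)
    (cong suc (trans (ℕ.+-suc t t) (cong (λ a → suc (t ℕ.+ a)) (sym (ℕ.+-identityʳ t))))))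

  p-agree : ∀ r → 1 ≤ r → r ≤ 2 * t → p r (v ++ neg y) ≡ p r (neg v ++ y)
  p-agree r 1≤r r≤2t with parity r
  ... | inj₁ ev = begin
    p r (v ++ neg y)          ≡⟨ p-++ r v (neg y) ⟩
    p r v ℤ.+ p r (neg y)     ≡⟨ cong₂ ℤ._+_ (sym (p-neg-even {r} ev v)) (p-neg-even {r} ev y) ⟩
    p r (neg v) ℤ.+ p r y     ≡⟨ p-++ r (neg v) y ⟨
    p r (neg v ++ y)          ∎
  ... | inj₂ (j , refl) = begin
    p r (v ++ neg y)          ≡⟨ p-++ r v (neg y) ⟩
    p r v ℤ.+ p r (neg y)     ≡⟨ cong₂ ℤ._+_ pv≡py (p-neg-odd {r} od y) ⟩
    p r y ℤ.+ ℤ.- p r y       ≡⟨ ℤ.+-comm (p r y) (ℤ.- p r y) ⟩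
    ℤ.- p r y ℤ.+ p r y       ≡⟨ cong (λ a → ℤ.- a ℤ.+ p r y) pv≡py ⟨
    ℤ.- p r v ℤ.+ p r y       ≡⟨ cong (λ a → a ℤ.+ p r y) (p-neg-odd {r} od v) ⟨
    p r (neg v) ℤ.+ p r y     ≡⟨ p-++ r (neg v) y ⟨
    p r (neg v ++ y)          ∎
    where
    od : Odd r
    od = odd-power j
    pv≡py : p r v ≡ p r y
    -- For r = suc (2 * j) the bound r ≤ 2 * t is by definition 2 * j < 2 * t.
    pv≡py = p≡ j (ℕ.*-cancelˡ-< 2 j t r≤2t)

  difference = lin-difference (2 * t) (v ++ neg y) (neg v ++ y)
    (length≡ v (neg y) |v| (trans (length-map (λ x → ℤ.- x) y) |y|))
    (length≡ (neg v) y (trans (length-map (λ x → ℤ.- x) v) |v|) |y|) p-agree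
  c = proj₁ difference
  affine = proj₂ difference

  lemma : ∀ s a b → a ℤ.* (s ℤ.* b) ≡ s ℤ.* a ℤ.* b
  lemma = ℤSolver.solve-∀
  constant : lin 0ℤ (v ++ neg y) ℤ.- lin 0ℤ (neg v ++ y) ≡ 0ℤ
  constant = ℤ.i≡j⇒i-j≡0 {lin 0ℤ (v ++ neg y)} (begin
    lin 0ℤ (v ++ neg y)
      ≡⟨ lin-++ 0ℤ v (neg y) ⟩
    lin 0ℤ v ℤ.* lin 0ℤ (neg y)
      ≡⟨ cong (λ a → lin 0ℤ v ℤ.* a) (trans (lin-zero-neg y) (cong (λ n → (ℤ.- 1ℤ) ℤ.^ n ℤ.* lin 0ℤ y) |y|)) ⟩
    lin 0ℤ v ℤ.* ((ℤ.- 1ℤ) ℤ.^ suc t ℤ.* lin 0ℤ y)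
      ≡⟨ lemma ((ℤ.- 1ℤ) ℤ.^ suc t) (lin 0ℤ v) (lin 0ℤ y) ⟩
    (ℤ.- 1ℤ) ℤ.^ suc t ℤ.* lin 0ℤ v ℤ.* lin 0ℤ y
      ≡⟨ cong (λ a → a ℤ.* lin 0ℤ y) (trans (lin-zero-neg v) (cong (λ n → (ℤ.- 1ℤ) ℤ.^ n ℤ.* lin 0ℤ v) |v|)) ⟨
    lin 0ℤ (neg v) ℤ.* lin 0ℤ y
      ≡⟨ lin-++ 0ℤ (neg v) y ⟨
    lin 0ℤ (neg v ++ y) ∎)

-- The product of the sums of pairs

module _ {A : Set} where

  Π : (A → ℕ) → List A → ℕ
  Π f xs = product (map f xs)

  Π-cong : ∀ {f g : A → ℕ} xs → (∀ {x} → x ∈ xs → f x ≡ g x) → Π f xs ≡ Π g xs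
  Π-cong []       f≡g = refl
  Π-cong (x ∷ xs) f≡g = cong₂ _*_ (f≡g (here refl)) (Π-cong xs (f≡g ∘ there))

  Π-* : ∀ (f g : A → ℕ) xs → Π (λ x → f x * g x) xs ≡ Π f xs * Π g xs
  Π-* f g []       = refl
  Π-* f g (x ∷ xs) = trans (cong (f x * g x *_) (Π-* f g xs))
    (lemma (f x) (g x) (Π f xs) (Π g xs))
    where
    lemma : ∀ a b c d → a * b * (c * d) ≡ a * c * (b * d)
    lemma = solve-∀

  Π-const : ∀ n (xs : List A) → Π (λ _ → n) xs ≡ n ^ length xs
  Π-const n []       = refl
  Π-const n (x ∷ xs) = cong (n *_) (Π-const n xs)

  Π-nonZero : ∀ (f : A → ℕ) xs → (∀ {x} → x ∈ xs → f x ≢ 0) → Π f xs ≢ 0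
  Π-nonZero f (x ∷ xs) f≢0 Π≡0 =
    [ f≢0 (here refl) , Π-nonZero f xs (f≢0 ∘ there) ]′ (ℕ.m*n≡0⇒m≡0∨n≡0 (f x) Π≡0)

  pairs : (A → A → ℕ) → List A → ℕ
  pairs f []       = 1
  pairs f (x ∷ xs) = Π (f x) xs * pairs f xs

  -- Each diagonal entry occurs once and each off-diagonal entry twice.
  Π-symmetric : ∀ (f : A → A → ℕ) → (∀ x y → f x y ≡ f y x) → ∀ xs →
    Π (λ x → Π (f x) xs) xs ≡ Π (λ x → f x x) xs * (pairs f xs * pairs f xs)
  Π-symmetric f f-sym []       = refl
  Π-symmetric f f-sym (x ∷ xs) = begin
    f x x * Π (f x) xs * Π (λ y → f y x * Π (f y) xs) xs
      ≡⟨ cong (f x x * Π (f x) xs *_) (Π-* (λ y → f y x) (λ y → Π (f y) xs) xs) ⟩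
    f x x * Π (f x) xs * (Π (λ y → f y x) xs * Π (λ y → Π (f y) xs) xs)
      ≡⟨ cong₂ (λ a b → f x x * Π (f x) xs * (a * b))
           (Π-cong xs (λ {y} _ → f-sym y x)) (Π-symmetric f f-sym xs) ⟩
    f x x * Π (f x) xs * (Π (f x) xs * (Π (λ y → f y y) xs * (pairs f xs * pairs f xs)))
      ≡⟨ lemma (f x x) (Π (f x) xs) (Π (λ y → f y y) xs) (pairs f xs) ⟩
    f x x * Π (λ y → f y y) xs * (Π (f x) xs * pairs f xs * (Π (f x) xs * pairs f xs)) ∎
    where
    open ≡-Reasoning
    lemma : ∀ a b c d → a * b * (b * (c * (d * d))) ≡ a * c * (b * d * (b * d))
    lemma = solve-∀

  ∈⇒∣Π : ∀ (f : A → ℕ) {x xs} → x ∈ xs → f x ∣ Π f xs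
  ∈⇒∣Π f {x} {_ ∷ xs} (here refl) = m∣m*n (Π f xs)
  ∈⇒∣Π f {x} {y ∷ xs} (there x∈)  = ∣n⇒∣m*n (f y) (∈⇒∣Π f x∈)

  all-∣pairs : ∀ (f : A → A → ℕ) xs → AllPairs (λ x y → f x y ∣ pairs f xs) xs
  all-∣pairs f []       = []
  all-∣pairs f (x ∷ xs) =
    All.tabulate (λ y∈ → ∣-trans (∈⇒∣Π (f x) y∈) (m∣m*n (pairs f xs))) ∷
    AllPairs.map (∣n⇒∣m*n (Π (f x) xs)) (all-∣pairs f xs)

  pairs-nonZero : ∀ (f : A → A → ℕ) xs → (∀ {x y} → x ∈ xs → y ∈ xs → f x y ≢ 0) → pairs f xs ≢ 0
  pairs-nonZero f (x ∷ xs) f≢0 eq =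
    [ Π-nonZero (f x) xs (f≢0 (here refl) ∘ there)
    , pairs-nonZero f xs (λ x∈ y∈ → f≢0 (there x∈) (there y∈))
    ]′ (ℕ.m*n≡0⇒m≡0∨n≡0 (Π (f x) xs) eq)

  Π-≤ : ∀ (f : A → ℕ) B xs → (∀ {x} → x ∈ xs → f x ≤ B) → Π f xs ≤ B ^ length xs
  Π-≤ f B []       f≤B = ℕ.≤-refl
  Π-≤ f B (x ∷ xs) f≤B = ℕ.*-mono-≤ (f≤B (here refl)) (Π-≤ f B xs (f≤B ∘ there))

  -- There are n(n-1)/2 factors for a list of length n; the generous exponent n * n keeps the
  -- induction simple.
  pairs-≤ : ∀ (f : A → A → ℕ) B .{{_ : NonZero B}} xs → (∀ {x y} → x ∈ xs → y ∈ xs → f x y ≤ B) →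
    pairs f xs ≤ B ^ (length xs * length xs)
  pairs-≤ f B []       f≤B = ℕ.≤-refl
  pairs-≤ f B (x ∷ xs) f≤B = begin
    Π (f x) xs * pairs f xs
      ≤⟨ ℕ.*-mono-≤ (Π-≤ (f x) B xs (f≤B (here refl) ∘ there))
                    (pairs-≤ f B xs λ x∈ y∈ → f≤B (there x∈) (there y∈)) ⟩
    B ^ n * B ^ (n * n)
      ≡⟨ ℕ.^-distribˡ-+-* B n (n * n) ⟨
    B ^ (n ℕ.+ n * n)
      ≤⟨ ℕ.^-monoʳ-≤ B (ℕ.+-mono-≤ (ℕ.n≤1+n n) (ℕ.*-monoʳ-≤ n (ℕ.n≤1+n n))) ⟩
    B ^ (suc n * suc n) ∎
    where
    open ℕ.≤-Reasoning
    n = length xs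

module _ {A B : Set} where

  Π-swap : ∀ (f : A → B → ℕ) xs ys → Π (λ x → Π (f x) ys) xs ≡ Π (λ y → Π (λ x → f x y) xs) ys
  Π-swap f []       ys = sym (trans (Π-const 1 ys) (ℕ.^-zeroˡ (length ys)))
  Π-swap f (x ∷ xs) ys = trans (cong (Π (f x) ys *_) (Π-swap f xs ys))
    (sym (Π-* (f x) (λ y → Π (λ x → f x y) xs) ys))

-- Sums of pairs, and the comparison of two lists with equal odd power sums

gap : ℤ → ℤ → ℕ
gap a b = ∣ a ℤ.+ b ∣

gap-sym : ∀ a b → gap a b ≡ gap b a
gap-sym a b = cong ∣_∣ (ℤ.+-comm a b)

∣lin∣ : ∀ X xs → ∣ lin X xs ∣ ≡ Π (gap X) xs
∣lin∣ X []       = refl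
∣lin∣ X (x ∷ xs) = trans (ℤ.∣i*j∣≡∣i∣*∣j∣ (X ℤ.+ x) (lin X xs)) (cong (gap X x *_) (∣lin∣ X xs))

∣lin-neg∣ : ∀ X xs → ∣ lin X (neg xs) ∣ ≡ Π (λ x → ∣ X ℤ.- x ∣) xs
∣lin-neg∣ X []       = refl
∣lin-neg∣ X (x ∷ xs) =
  trans (ℤ.∣i*j∣≡∣i∣*∣j∣ (X ℤ.- x) (lin X (neg xs))) (cong (∣ X ℤ.- x ∣ *_) (∣lin-neg∣ X xs))

lin-neg-root : ∀ {a xs} → a ∈ xs → lin a (neg xs) ≡ 0ℤ
lin-neg-root {a} {_ ∷ xs} (here refl) =
  trans (cong (ℤ._* lin a (neg xs)) (ℤ.+-inverseʳ a)) (ℤ.*-zeroˡ (lin a (neg xs)))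
lin-neg-root {a} {x ∷ xs} (there a∈) =
  trans (cong ((a ℤ.- x) ℤ.*_) (lin-neg-root a∈)) (ℤ.*-zeroʳ (a ℤ.- x))

lin-neg-root⁻ : ∀ {a} xs → lin a (neg xs) ≡ 0ℤ → a ∈ xs
lin-neg-root⁻ {a} (x ∷ xs) eq with ℤ.i*j≡0⇒i≡0∨j≡0 (a ℤ.- x) eq
... | inj₁ a-x≡0 = here (ℤ.i-j≡0⇒i≡j a x a-x≡0)
... | inj₂ eq′   = there (lin-neg-root⁻ xs eq′)

-- Here a and b may be the same entry, so 0 is excluded as well and the diagonal factors 2|a| are
-- nonzero.
SumFree : List ℤ → Set
SumFree v = ∀ a b → a ∈ v → b ∈ v → a ℤ.+ b ≢ 0ℤ

gap≢0 : ∀ {v} → SumFree v → ∀ {a b} → a ∈ v → b ∈ v → gap a b ≢ 0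
gap≢0 v-free a∈ b∈ = v-free _ _ a∈ b∈ ∘ ℤ.∣i∣≡0⇒i≡0

norm≢0 : ∀ {v} → SumFree v → ∀ {a} → a ∈ v → ∣ a ∣ ≢ 0
norm≢0 v-free {a} a∈ ∣a∣≡0 with refl ← ℤ.∣i∣≡0⇒i≡0 {a} ∣a∣≡0 = v-free _ _ a∈ a∈ refl

gap-diagonal : ∀ v → Π (λ a → gap a a) v ≡ 2 ^ length v * Π ∣_∣ v
gap-diagonal v = begin
  Π (λ a → gap a a) v            ≡⟨ Π-cong v (λ {a} _ → double a) ⟩
  Π (λ a → 2 * ∣ a ∣) v          ≡⟨ Π-* (λ _ → 2) ∣_∣ v ⟩
  Π (λ _ → 2) v * Π ∣_∣ v        ≡⟨ cong (_* Π ∣_∣ v) (Π-const 2 v) ⟩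
  2 ^ length v * Π ∣_∣ v         ∎
  where
  open ≡-Reasoning
  double : ∀ a → gap a a ≡ 2 * ∣ a ∣
  double a = trans (cong ∣_∣ (2* a)) (ℤ.∣i*j∣≡∣i∣*∣j∣ (+ 2) a)
    where
    2* : ∀ a → a ℤ.+ a ≡ + 2 ℤ.* a
    2* = ℤSolver.solve-∀

-- Evaluating Π(X+v)·Π(X−y) − Π(X−v)·Π(X+y) = cX at X ∈ v, resp. X ∈ y, kills one of the
-- two products.  If c = 0 this makes every element of v a root of Π(X−y); otherwise multiplying
-- over X ∈ v, resp. X ∈ y, yields 2ⁿ·pairs(v)²·R = |c|ⁿ = 2ⁿ·pairs(y)²·R with R = Π |v_i − y_j|.
module _ {t v y} (|v| : length v ≡ suc t) (|y| : length y ≡ suc t)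
         (v-free : SumFree v) (y-free : SumFree y) (c : ℤ)
         (affine : ∀ X → lin X v ℤ.* lin X (neg y) ℤ.- lin X (neg v) ℤ.* lin X y ≡ X ℤ.* c) where

  private
    R : ℕ
    R = Π (λ a → Π (λ b → ∣ a ℤ.- b ∣) y) v

    at-v : ∀ {a} → a ∈ v → lin a v ℤ.* lin a (neg y) ≡ a ℤ.* c
    at-v {a} a∈ = begin
      lin a v ℤ.* lin a (neg y)                                    ≡⟨ ℤ.+-identityʳ _ ⟨
      lin a v ℤ.* lin a (neg y) ℤ.- 0ℤ ℤ.* lin a y
        ≡⟨ cong (λ z → lin a v ℤ.* lin a (neg y) ℤ.- z ℤ.* lin a y) (lin-neg-root a∈) ⟨
      lin a v ℤ.* lin a (neg y) ℤ.- lin a (neg v) ℤ.* lin a y     ≡⟨ affine a ⟩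
      a ℤ.* c                                                      ∎
      where open ≡-Reasoning

    at-y : ∀ {b} → b ∈ y → lin b y ℤ.* lin b (neg v) ≡ ℤ.- (b ℤ.* c)
    at-y {b} b∈ = begin
      lin b y ℤ.* lin b (neg v)                                        ≡⟨ lemma (lin b v) (lin b (neg v)) (lin b y) ⟩
      ℤ.- (lin b v ℤ.* 0ℤ ℤ.- lin b (neg v) ℤ.* lin b y)
        ≡⟨ cong (λ z → ℤ.- (lin b v ℤ.* z ℤ.- lin b (neg v) ℤ.* lin b y)) (lin-neg-root b∈) ⟨
      ℤ.- (lin b v ℤ.* lin b (neg y) ℤ.- lin b (neg v) ℤ.* lin b y)    ≡⟨ cong (λ z → ℤ.- z) (affine b) ⟩
      ℤ.- (b ℤ.* c)                                                    ∎
      where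
      open ≡-Reasoning
      lemma : ∀ a s b → b ℤ.* s ≡ ℤ.- (a ℤ.* 0ℤ ℤ.- s ℤ.* b)
      lemma = ℤSolver.solve-∀

    -- Shared by v and y, with f a the product of |a - b| over the other list. Multiplying `f≡` over
    -- u gives the product of all gaps, diagonal included, which `Π-symmetric` splits into 2^(t+1) N
    -- and D². Then N cancels, because a sum-free list omits 0.
    product-identity : ∀ u → length u ≡ suc t → SumFree u → (f : ℤ → ℕ) →
      (∀ {a} → a ∈ u → Π (gap a) u * f a ≡ ∣ a ∣ * ∣ c ∣) → Π f u ≡ R →
      2 ^ suc t * (pairs gap u * pairs gap u) * R ≡ ∣ c ∣ ^ suc t
    product-identity u |u| u-free f f≡ Πf≡R =
      ℕ.*-cancelˡ-≡ _ _ N {{ℕ.≢-nonZero (Π-nonZero ∣_∣ u (norm≢0 u-free))}} (begin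
        N * (2 ^ suc t * (D * D) * R)           ≡⟨ lemma N (2 ^ suc t) (D * D) R ⟩
        2 ^ suc t * N * (D * D) * R             ≡⟨ cong₂ (λ n r → 2 ^ n * N * (D * D) * r) |u| Πf≡R ⟨
        2 ^ length u * N * (D * D) * Π f u      ≡⟨ cong (λ z → z * (D * D) * Π f u) (gap-diagonal u) ⟨
        Π (λ a → gap a a) u * (D * D) * Π f u   ≡⟨ cong (_* Π f u) (Π-symmetric gap gap-sym u) ⟨
        Π (λ a → Π (gap a) u) u * Π f u         ≡⟨ Π-* (λ a → Π (gap a) u) f u ⟨
        Π (λ a → Π (gap a) u * f a) u           ≡⟨ Π-cong u f≡ ⟩
        Π (λ a → ∣ a ∣ * ∣ c ∣) u               ≡⟨ Π-* ∣_∣ (λ _ → ∣ c ∣) u ⟩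
        N * Π (λ _ → ∣ c ∣) u                   ≡⟨ cong (N *_) (trans (Π-const ∣ c ∣ u) (cong (∣ c ∣ ^_) |u|)) ⟩
        N * ∣ c ∣ ^ suc t                       ∎)
      where
      open ≡-Reasoning
      N = Π ∣_∣ u
      D = pairs gap u
      lemma : ∀ n p d r → n * (p * d * r) ≡ p * n * d * r
      lemma = solve-∀

    identity-v : 2 ^ suc t * (pairs gap v * pairs gap v) * R ≡ ∣ c ∣ ^ suc t
    identity-v = product-identity v |v| v-free (λ a → Π (λ b → ∣ a ℤ.- b ∣) y)
      (λ {a} a∈ → begin
        Π (gap a) v * Π (λ b → ∣ a ℤ.- b ∣) y   ≡⟨ cong₂ _*_ (∣lin∣ a v) (∣lin-neg∣ a y) ⟨
        ∣ lin a v ∣ * ∣ lin a (neg y) ∣         ≡⟨ ℤ.∣i*j∣≡∣i∣*∣j∣ (lin a v) _ ⟨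
        ∣ lin a v ℤ.* lin a (neg y) ∣           ≡⟨ cong ∣_∣ (at-v a∈) ⟩
        ∣ a ℤ.* c ∣                             ≡⟨ ℤ.∣i*j∣≡∣i∣*∣j∣ a c ⟩
        ∣ a ∣ * ∣ c ∣                           ∎)
      refl
      where open ≡-Reasoning

    identity-y : 2 ^ suc t * (pairs gap y * pairs gap y) * R ≡ ∣ c ∣ ^ suc t
    identity-y = product-identity y |y| y-free (λ b → Π (λ a → ∣ b ℤ.- a ∣) v)
      (λ {b} b∈ → begin
        Π (gap b) y * Π (λ a → ∣ b ℤ.- a ∣) v   ≡⟨ cong₂ _*_ (∣lin∣ b y) (∣lin-neg∣ b v) ⟨
        ∣ lin b y ∣ * ∣ lin b (neg v) ∣         ≡⟨ ℤ.∣i*j∣≡∣i∣*∣j∣ (lin b y) _ ⟨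
        ∣ lin b y ℤ.* lin b (neg v) ∣           ≡⟨ cong ∣_∣ (at-y b∈) ⟩
        ∣ ℤ.- (b ℤ.* c) ∣                       ≡⟨ ℤ.∣-i∣≡∣i∣ (b ℤ.* c) ⟩
        ∣ b ℤ.* c ∣                             ≡⟨ ℤ.∣i*j∣≡∣i∣*∣j∣ b c ⟩
        ∣ b ∣ * ∣ c ∣                           ∎)
      (trans (Π-swap (λ b a → ∣ b ℤ.- a ∣) y v)
        (Π-cong v λ {a} _ → Π-cong y λ {b} _ → ℤ.∣i-j∣≡∣j-i∣ b a))
      where open ≡-Reasoning

  ⊆-or-equal-pairs : v ⊆ y ⊎ pairs gap v * pairs gap v ≡ pairs gap y * pairs gap y
  ⊆-or-equal-pairs with c ℤ.≟ 0ℤ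
  ... | yes refl = inj₁ λ {a} a∈ → lin-neg-root⁻ y
    ([ (λ eq → contradiction (trans (sym (∣lin∣ a v)) (cong ∣_∣ eq)) (Π-nonZero (gap a) v (gap≢0 v-free a∈)))
     , (λ eq → eq)
     ]′ (ℤ.i*j≡0⇒i≡0∨j≡0 (lin a v) (trans (at-v a∈) (ℤ.*-zeroʳ a))))
  ... | no c≢0 = inj₂ (ℕ.*-cancelˡ-≡ _ _ (2 ^ suc t) {{ℕ.m^n≢0 2 (suc t)}}
    (ℕ.*-cancelʳ-≡ _ _ R {{ℕ.≢-nonZero R≢0}} (trans identity-v (sym identity-y))))
    where
    -- By `identity-v`, R is a factor of |c|^(t+1), so it vanishes only if c does.
    R≢0 : R ≢ 0
    R≢0 R≡0 = c≢0 (ℤ.∣i∣≡0⇒i≡0 (ℕ.m^n≡0⇒m≡0 ∣ c ∣ (suc t) (begin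
      ∣ c ∣ ^ suc t                                   ≡⟨ identity-v ⟨
      2 ^ suc t * (pairs gap v * pairs gap v) * R     ≡⟨ cong (2 ^ suc t * (pairs gap v * pairs gap v) *_) R≡0 ⟩
      2 ^ suc t * (pairs gap v * pairs gap v) * 0     ≡⟨ ℕ.*-zeroʳ (2 ^ suc t * (pairs gap v * pairs gap v)) ⟩
      0                                               ∎)))
      where open ≡-Reasoning

odd-power-sums⇒⊆-or-equal-pairs : ∀ t v y → length v ≡ suc t → length y ≡ suc t →
  SumFree v → SumFree y →
  (∀ j → j < t → p (suc (2 * j)) v ≡ p (suc (2 * j)) y) →
  v ⊆ y ⊎ pairs gap v * pairs gap v ≡ pairs gap y * pairs gap y
odd-power-sums⇒⊆-or-equal-pairs t v y |v| |y| v-free y-free p≡ =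
  let c , affine = odd-power-sums⇒affine t v y |v| |y| p≡
  in ⊆-or-equal-pairs |v| |y| v-free y-free c affine

-- The divisor bound

-- Only an upper bound for the number of divisors is wanted, so L may contain repetitions and
-- non-divisors.
ContainsDivisors : ℕ → List ℕ → Set
ContainsDivisors N L = ∀ {d} → d ∣ N → d ∈ L

^-distribʳ-* : ∀ a m n → (m * n) ^ a ≡ m ^ a * n ^ a
^-distribʳ-* zero    m n = refl
^-distribʳ-* (suc a) m n = trans (cong (m * n *_) (^-distribʳ-* a m n)) (lemma m n (m ^ a) (n ^ a))
  where
  lemma : ∀ m n x y → m * n * (x * y) ≡ m * x * (n * y)
  lemma = solve-∀

timesPowers : ℕ → ℕ → List ℕ → List ℕ
timesPowers b zero    L = L
timesPowers b (suc e) L = L ++ map (b *_) (timesPowers b e L)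

length-timesPowers : ∀ b e L → length (timesPowers b e L) ≡ suc e * length L
length-timesPowers b zero    L = sym (ℕ.+-identityʳ (length L))
length-timesPowers b (suc e) L = trans (length-++ L)
  (cong (length L ℕ.+_) (trans (length-map (b *_) (timesPowers b e L)) (length-timesPowers b e L)))

prime∤⇒coprime : ∀ {p d} → Prime p → p ∤ d → Coprime d p
prime∤⇒coprime p-prime p∤d (i∣d , i∣p) with prime⇒irreducible p-prime i∣p
... | inj₁ i≡1  = i≡1
... | inj₂ refl = contradiction i∣d p∤d

coprime-^-divisor : ∀ {d b M} e → Coprime d b → d ∣ b ^ e * M → d ∣ M
coprime-^-divisor {d} {b} {M} zero    cop d∣ = subst (d ∣_) (ℕ.*-identityˡ M) d∣
coprime-^-divisor {d} {b} {M} (suc e) cop d∣ =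
  coprime-^-divisor e cop (coprime-divisor cop (subst (d ∣_) (ℕ.*-assoc b (b ^ e) M) d∣))

-- If b divides d, one factor b is removed from d and from b^e; otherwise d is coprime to b, hence
-- divides M and lies in the first block L.
timesPowers-divisors : ∀ {b M L} e → Prime b → ContainsDivisors M L →
  ContainsDivisors (b ^ e * M) (timesPowers b e L)
timesPowers-divisors {b} {M} zero b-prime L∋ d∣ = L∋ (subst (_ ∣_) (ℕ.*-identityˡ M) d∣)
timesPowers-divisors {b} {M} {L} (suc e) b-prime L∋ {d} d∣ with b ∣? d
... | yes (divides q refl) = ∈-++⁺ʳ L
  (subst (_∈ map (b *_) (timesPowers b e L)) (ℕ.*-comm b q)
    (∈-map⁺ (b *_) (timesPowers-divisors e b-prime L∋
      (*-cancelˡ-∣ b {{prime⇒nonZero b-prime}}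
        (subst₂ _∣_ (ℕ.*-comm q b) (ℕ.*-assoc b (b ^ e) M) d∣)))))
... | no b∤d = ∈-++⁺ˡ (L∋ (coprime-^-divisor (suc e) (prime∤⇒coprime b-prime b∤d) d∣))

-- This is the bound O(N^(1/a)) for the number of divisors, raised to the a-th power so as to stay
-- within ℕ.
DivisorBound : ℕ → ℕ → ℕ → Set
DivisorBound a C N = ∃[ L ] (ContainsDivisors N L × length L ^ a ≤ C * N)

-- Each prime factor at most doubles the list; the a-th power of its length grows by 2^a, which is
-- at most p. Repeated primes are simply treated one at a time.
large-primes : ∀ a ps → All Prime ps → All (2 ^ a ≤_) ps → DivisorBound a 1 (product ps)
large-primes a []       []         []         =
  1 ∷ [] , (λ d∣1 → here (∣1⇒≡1 d∣1)) , ℕ.≤-reflexive (ℕ.^-zeroˡ a)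
large-primes a (p ∷ ps) (pp ∷ pps) (ple ∷ les) with large-primes a ps pps les
... | L , L∋ , |L| = timesPowers p 1 L
  , (λ d∣ → timesPowers-divisors 1 pp L∋ (subst (λ q → _ ∣ q * product ps) (sym (ℕ.*-identityʳ p)) d∣))
  , (begin
    length (timesPowers p 1 L) ^ a      ≡⟨ cong (_^ a) (length-timesPowers p 1 L) ⟩
    (2 * length L) ^ a                  ≡⟨ ^-distribʳ-* a 2 (length L) ⟩
    2 ^ a * length L ^ a                ≤⟨ ℕ.*-mono-≤ ple |L| ⟩
    p * (1 * product ps)                ≡⟨ lemma p (product ps) ⟩
    1 * (p * product ps)                ∎)
  where
  open ℕ.≤-Reasoning
  lemma : ∀ p q → p * (1 * q) ≡ 1 * (p * q)
  lemma = solve-∀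

factors-≥ : ∀ {b} ps → All Prime ps → b Rough product ps → All (b ≤_) ps
factors-≥ []       []         rough = []
factors-≥ (p ∷ ps) (pp ∷ pps) rough =
  rough⇒≤ {{prime⇒nonTrivial pp}} (rough∧∣⇒rough rough (m∣m*n (product ps)))
  ∷ factors-≥ ps pps (rough∧∣⇒rough rough (n∣m*n p))

rough-divisorBound : ∀ a {b} → 2 ^ a ≤ b → ∀ N .{{_ : NonZero N}} → b Rough N → DivisorBound a 1 N
rough-divisorBound a 2^a≤b N rough =
  subst (DivisorBound a 1) (sym isFactorisation)
    (large-primes a factors factorsPrime
      (All.map (ℕ.≤-trans 2^a≤b) (factors-≥ factors factorsPrime (subst (_ Rough_) isFactorisation rough))))
  where open PrimeFactorisation (factorise N)

suc≤2^ : ∀ q → suc q ≤ 2 ^ q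
suc≤2^ zero    = ℕ.≤-refl
suc≤2^ (suc q) = begin
  1 ℕ.+ suc q         ≤⟨ ℕ.+-mono-≤ (ℕ.m^n>0 2 q) (suc≤2^ q) ⟩
  2 ^ q ℕ.+ 2 ^ q     ≡⟨ cong (2 ^ q ℕ.+_) (ℕ.+-identityʳ (2 ^ q)) ⟨
  2 ^ suc q           ∎
  where open ℕ.≤-Reasoning

-- With q = ⌊e/a⌋ one has e + 1 ≤ (q+1)a ≤ 2^q a, and qa ≤ e. This absorbs the factor e + 1 coming
-- from a prime power b^e.
suc^≤ : ∀ a .{{_ : NonZero a}} e → suc e ^ a ≤ a ^ a * 2 ^ e
suc^≤ a e = begin
  suc e ^ a                         ≤⟨ ℕ.^-monoˡ-≤ a suc-e≤ ⟩
  (2 ^ q * a) ^ a                   ≡⟨ ^-distribʳ-* a (2 ^ q) a ⟩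
  (2 ^ q) ^ a * a ^ a               ≡⟨ cong (_* a ^ a) (ℕ.^-*-assoc 2 q a) ⟩
  2 ^ (q * a) * a ^ a               ≡⟨ ℕ.*-comm (2 ^ (q * a)) (a ^ a) ⟩
  a ^ a * 2 ^ (q * a)               ≤⟨ ℕ.*-monoʳ-≤ (a ^ a) (ℕ.^-monoʳ-≤ 2 qa≤e) ⟩
  a ^ a * 2 ^ e                     ∎
  where
  open ℕ.≤-Reasoning
  q = e ℕ./ a
  qa≤e : q * a ≤ e
  qa≤e = subst (q * a ≤_) (sym (m≡m%n+[m/n]*n e a)) (ℕ.m≤n+m (q * a) (e % a))
  suc-e≤ : suc e ≤ 2 ^ q * a
  suc-e≤ = begin
    suc e                   ≡⟨ cong suc (m≡m%n+[m/n]*n e a) ⟩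
    suc (e % a) ℕ.+ q * a   ≤⟨ ℕ.+-monoˡ-≤ (q * a) (m%n<n e a) ⟩
    suc q * a               ≤⟨ ℕ.*-monoˡ-≤ a (suc≤2^ q) ⟩
    2 ^ q * a               ∎

-- Here b runs through all integers from 2 on, prime or not. A composite b never divides a b-rough
-- N, so its exponent is 0; `prime-if` records that a positive exponent forces b to be prime.
record Peeled (b N : ℕ) : Set where
  field
    exponent cofactor : ℕ
    eq                : N ≡ b ^ exponent * cofactor
    rough             : suc b Rough cofactor
    nonZero           : NonZero cofactor
    prime-if          : exponent ≢ 0 → Prime b

peel : ∀ b .{{_ : NonTrivial b}} N → NonZero N → b Rough N → Peeled b N
peel b = <-rec (λ N → NonZero N → b Rough N → Peeled b N) step
  where
  step : ∀ N → (∀ {M} → M < N → NonZero M → b Rough M → Peeled b M) →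
    NonZero N → b Rough N → Peeled b N
  step N rec N≢0 rough with b ∣? N
  ... | no b∤N = record
    { exponent = 0 ; cofactor = N ; eq = sym (ℕ.*-identityˡ N)
    ; rough = ∤⇒rough-suc b∤N rough ; nonZero = N≢0 ; prime-if = contradiction refl }
  ... | yes b∣N@(divides M refl) = record
    { exponent = suc exponent ; cofactor = cofactor
    ; eq = trans (ℕ.*-comm M b) (trans (cong (b *_) eq) (sym (ℕ.*-assoc b (b ^ exponent) cofactor)))
    ; rough = rough′ ; nonZero = nonZero ; prime-if = λ _ → rough∧∣⇒prime rough b∣N }
    where
    M≢0 : NonZero M
    M≢0 = ℕ.m*n≢0⇒m≢0 M {b} {{N≢0}}
    open Peeled (rec (ℕ.m<m*n M b {{M≢0}} (ℕ.nonTrivial⇒n>1 b)) M≢0 (rough∧∣⇒rough rough (m∣m*n b)))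
      renaming (rough to rough′)

-- Restoring b^e multiplies the length by e + 1, whose a-th power is at most a^a 2^e ≤ a^a b^e. So
-- admitting b as a factor costs a^a in the constant.
divisorBound-peel : ∀ a .{{_ : NonZero a}} b .{{_ : NonTrivial b}} C →
  (∀ N .{{_ : NonZero N}} → suc b Rough N → DivisorBound a C N) →
  ∀ N .{{_ : NonZero N}} → b Rough N → DivisorBound a (a ^ a * C) N
divisorBound-peel a b C bound N {{N≢0}} b-rough = bound′ (bound cofactor {{nonZero}} rough)
  where
  open Peeled (peel b N (ℕ.≢-nonZero (ℕ.≢-nonZero⁻¹ N)) b-rough)
  open ℕ.≤-Reasoning
  contains : ∀ e → (e ≢ 0 → Prime b) → ∀ {L} → ContainsDivisors cofactor L →
    ContainsDivisors (b ^ e * cofactor) (timesPowers b e L)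
  contains zero    _       L∋ d∣ = L∋ (subst (_ ∣_) (ℕ.*-identityˡ cofactor) d∣)
  contains (suc e) b-prime L∋ = timesPowers-divisors (suc e) (b-prime λ ()) L∋
  lemma : ∀ x y z w → x * y * (z * w) ≡ x * z * (y * w)
  lemma = solve-∀
  bound′ : DivisorBound a C cofactor → DivisorBound a (a ^ a * C) N
  bound′ (L , L∋ , |L|) = timesPowers b exponent L
    , subst (λ n → ContainsDivisors n (timesPowers b exponent L)) (sym eq) (contains exponent prime-if L∋)
    , (begin
      length (timesPowers b exponent L) ^ a        ≡⟨ cong (_^ a) (length-timesPowers b exponent L) ⟩
      (suc exponent * length L) ^ a                ≡⟨ ^-distribʳ-* a (suc exponent) (length L) ⟩
      suc exponent ^ a * length L ^ a              ≤⟨ ℕ.*-mono-≤ (suc^≤ a exponent) |L| ⟩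
      a ^ a * 2 ^ exponent * (C * cofactor)        ≤⟨ ℕ.*-monoˡ-≤ (C * cofactor) (ℕ.*-monoʳ-≤ (a ^ a)
                                                        (ℕ.^-monoˡ-≤ exponent (ℕ.nonTrivial⇒n>1 b))) ⟩
      a ^ a * b ^ exponent * (C * cofactor)        ≡⟨ lemma (a ^ a) (b ^ exponent) C cofactor ⟩
      a ^ a * C * (b ^ exponent * cofactor)        ≡⟨ cong (a ^ a * C *_) eq ⟨
      a ^ a * C * N                                ∎)

-- Primes p ≥ 2^a satisfy 2^a ≤ p, so only the finitely many b < 2^a cost a constant.
divisorBound-rough : ∀ a .{{_ : NonZero a}} i b .{{_ : NonTrivial b}} → 2 ^ a ≤ i ℕ.+ b →
  ∃[ C ] (∀ N .{{_ : NonZero N}} → b Rough N → DivisorBound a C N)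
divisorBound-rough a zero    b 2^a≤ = 1 , rough-divisorBound a 2^a≤
divisorBound-rough a (suc i) b 2^a≤ =
  let C , bound = divisorBound-rough a i (suc b) {{ℕ.n>1⇒nonTrivial (ℕ.m<n⇒m<1+n (ℕ.nonTrivial⇒n>1 b))}}
                    (subst (2 ^ a ≤_) (sym (ℕ.+-suc i b)) 2^a≤)
  in a ^ a * C , divisorBound-peel a b C bound

divisorBound : ∀ a .{{_ : NonZero a}} → ∃[ C ] (∀ N .{{_ : NonZero N}} → DivisorBound a C N)
divisorBound a =
  let C , bound = divisorBound-rough a (2 ^ a) 2 (ℕ.m≤m+n (2 ^ a) 2)
  in C , λ N → bound N 2-rough

-- Integer roots and a divisor bound uniform for N up to a power of P

root : ∀ m .{{_ : NonZero m}} M → ∃[ g ] (g ^ m ≤ M × M < suc g ^ m)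
root m@(suc _) zero = 0 , z≤n , ℕ.m^n>0 1 m
root m (suc M) with root m M
... | g , g^m≤M , M<sg^m with suc g ^ m ℕ.≤? suc M
...   | yes le = suc g , le , ℕ.≤-<-trans M<sg^m (ℕ.^-monoˡ-< m (ℕ.n<1+n (suc g)))
...   | no ¬le = g , ℕ.m≤n⇒m≤1+n g^m≤M , ℕ.≰⇒> ¬le

^-cancelˡ-≤ : ∀ e .{{_ : NonZero e}} {m n} → m ^ e ≤ n ^ e → m ≤ n
^-cancelˡ-≤ e m^e≤n^e = ℕ.≮⇒≥ λ n<m → ℕ.<⇒≱ (ℕ.^-monoˡ-< e n<m) m^e≤n^e

n≤n^ : ∀ e .{{_ : NonZero e}} n .{{_ : NonZero n}} → n ≤ n ^ e
n≤n^ (suc e) n = ℕ.m≤m*n n (n ^ e) {{ℕ.m^n≢0 n e}}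

-- Take G as the integer part of (C′P)^(1/d), which depends on P but not on N. With the divisor
-- bound for exponent dE, a list longer than G would have (length L)^d ≤ C′P < (G+1)^d ≤ (length
-- L)^d.
uniform-divisorBound : ∀ d .{{_ : NonZero d}} E .{{_ : NonZero E}} c → ∃[ C ] (∀ P .{{_ : NonZero P}} →
  ∃[ G ] (1 ≤ G × G ^ d ≤ C * P ×
    (∀ N .{{_ : NonZero N}} → N ≤ c * P ^ E → ∃[ L ] (ContainsDivisors N L × length L ≤ G))))
uniform-divisorBound d E c = C′ , uniform
  where
  instance
    dE≢0 : NonZero (d * E)
    dE≢0 = ℕ.m*n≢0 d E
  open ℕ.≤-Reasoning
  bound = divisorBound (d * E)
  C  = proj₁ bound
  -- Positivity of C′ gives both G ≥ 1 and C′ ≤ C′^E.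
  C′ = suc (C * c)
  uniform : ∀ P .{{_ : NonZero P}} → ∃[ G ] (1 ≤ G × G ^ d ≤ C′ * P ×
    (∀ N .{{_ : NonZero N}} → N ≤ c * P ^ E → ∃[ L ] (ContainsDivisors N L × length L ≤ G)))
  uniform P with root d (C′ * P)
  ... | G , G^d≤ , <sG^d = G , ℕ.n≢0⇒n>0 G≢0 , G^d≤ , small
    where
    C′P>0 : 0 < C′ * P
    C′P>0 = ℕ.>-nonZero⁻¹ (C′ * P) {{ℕ.m*n≢0 C′ P}}
    G≢0 : G ≢ 0
    G≢0 refl = ℕ.<⇒≱ <sG^d (subst (_≤ C′ * P) (sym (ℕ.^-zeroˡ d)) C′P>0)
    small : ∀ N .{{_ : NonZero N}} → N ≤ c * P ^ E → ∃[ L ] (ContainsDivisors N L × length L ≤ G)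
    small N N≤ with proj₂ bound N
    ... | L , L∋ , |L| = L , L∋ , ℕ.s≤s⁻¹ (ℕ.≰⇒> λ sG≤|L| → ℕ.<⇒≱ <sG^d (begin
      suc G ^ d       ≤⟨ ℕ.^-monoˡ-≤ d sG≤|L| ⟩
      length L ^ d    ≤⟨ ^-cancelˡ-≤ E (begin
        (length L ^ d) ^ E     ≡⟨ ℕ.^-*-assoc (length L) d E ⟩
        length L ^ (d * E)     ≤⟨ |L| ⟩
        C * N                  ≤⟨ ℕ.*-monoʳ-≤ C N≤ ⟩
        C * (c * P ^ E)        ≡⟨ ℕ.*-assoc C c (P ^ E) ⟨
        C * c * P ^ E          ≤⟨ ℕ.*-monoˡ-≤ (P ^ E) (ℕ.n≤1+n (C * c)) ⟩
        C′ * P ^ E             ≤⟨ ℕ.*-monoˡ-≤ (P ^ E) (n≤n^ E C′) ⟩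
        C′ ^ E * P ^ E         ≡⟨ ^-distribʳ-* E C′ P ⟨
        (C′ * P) ^ E           ∎) ⟩
      C′ * P          ∎))

-- Coverings by supports

module _ {A B C : Set} where

  length-cartesianProductWith : ∀ (f : A → B → C) xs ys →
    length (cartesianProductWith f xs ys) ≡ length xs * length ys
  length-cartesianProductWith f []       ys = refl
  length-cartesianProductWith f (x ∷ xs) ys = trans (length-++ (map (f x) ys))
    (cong₂ ℕ._+_ (length-map (f x) ys) (length-cartesianProductWith f xs ys))

module _ {A : Set} where

  words : ℕ → List A → List (List A)
  words zero    z = [] ∷ []
  words (suc n) z = cartesianProductWith _∷_ z (words n z)

  length-words : ∀ n (z : List A) → length (words n z) ≡ length z ^ n
  length-words zero    z = refl
  length-words (suc n) z = trans (length-cartesianProductWith _∷_ z (words n z))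
    (cong (length z *_) (length-words n z))

  ∈-words⁺ : ∀ {n} {z : List A} xs → length xs ≡ n → xs ⊆ z → xs ∈ words n z
  ∈-words⁺ []       refl xs⊆z = here refl
  ∈-words⁺ (x ∷ xs) refl xs⊆z =
    ∈-cartesianProductWith⁺ _∷_ (xs⊆z (here refl)) (∈-words⁺ xs refl (xs⊆z ∘ there))

  ∈-words⁻ : ∀ n {z : List A} {xs} → xs ∈ words n z → length xs ≡ n × xs ⊆ z
  ∈-words⁻ zero    (here refl) = refl , λ ()
  ∈-words⁻ (suc n) {z} xs∈
    with x , ys , x∈ , ys∈ , refl ← ∈-cartesianProductWith⁻ _∷_ z (words n z) xs∈
    with len , ys⊆z ← ∈-words⁻ n ys∈
    = cong suc len , λ { (here refl) → x∈ ; (there y∈) → ys⊆z y∈ }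

  ∈⇒↭ : ∀ {x : A} {xs} → x ∈ xs → ∃[ xs′ ] xs ↭ x ∷ xs′
  ∈⇒↭ x∈ with ys , zs , refl ← ∈-∃++ x∈ = ys ++ zs , shift _ ys zs

  AllPairs-resp-↭ : ∀ {R : A → A → Set} → (∀ {x y} → R x y → R y x) →
    ∀ {xs ys} → xs ↭ ys → AllPairs R xs → AllPairs R ys
  AllPairs-resp-↭ {R} R-sym xs↭ys =
    ↭ₛ.AllPairs-resp-↭ (setoid A) R-sym
      ((λ { refl r → r }) , (λ { refl r → r })) (↭⇒↭ₛ xs↭ys)

  -- Induct on xs, removing one occurrence of x from ys at each step. Only xs must be free of
  -- repetitions, so distinct solutions can be counted against a redundant list of candidates.
  Unique-⊆⇒length-≤ : ∀ {xs ys : List A} → Unique xs → xs ⊆ ys → length xs ≤ length ys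
  Unique-⊆⇒length-≤ {[]}     []            xs⊆ys = z≤n
  Unique-⊆⇒length-≤ {x ∷ xs} {ys} (x≢ ∷ unique) xs⊆ys with ∈⇒↭ (xs⊆ys (here refl))
  ... | ys′ , ys↭ = subst (suc (length xs) ≤_) (sym (↭-length ys↭)) (s≤s (Unique-⊆⇒length-≤ unique xs⊆ys′))
    where
    xs⊆ys′ : xs ⊆ ys′
    xs⊆ys′ y∈ with ∈-resp-↭ ys↭ (xs⊆ys (there y∈))
    ... | here refl = contradiction refl (All.lookup x≢ y∈)
    ... | there y∈′ = y∈′

  length-concatMap-≤ : ∀ {B : Set} {n} (f : A → List B) xs → (∀ {x} → x ∈ xs → length (f x) ≤ n) →
    length (concatMap f xs) ≤ length xs * n
  length-concatMap-≤ f []       f≤n = z≤n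
  length-concatMap-≤ f (x ∷ xs) f≤n = subst (_≤ _) (sym (length-++ (f x)))
    (ℕ.+-mono-≤ (f≤n (here refl)) (length-concatMap-≤ f xs (f≤n ∘ there)))

p-↭ : ∀ r {xs ys} → xs ↭ ys → p r xs ≡ p r ys
p-↭ r refl = refl
p-↭ r (prep x xs↭ys) = cong (λ s → x ℤ.^ r ℤ.+ s) (p-↭ r xs↭ys)
p-↭ r (swap {xs} {ys} x y xs↭ys) = begin
  x ℤ.^ r ℤ.+ (y ℤ.^ r ℤ.+ p r xs)   ≡⟨ cong (λ s → x ℤ.^ r ℤ.+ (y ℤ.^ r ℤ.+ s)) (p-↭ r xs↭ys) ⟩
  x ℤ.^ r ℤ.+ (y ℤ.^ r ℤ.+ p r ys)   ≡⟨ lemma (x ℤ.^ r) (y ℤ.^ r) (p r ys) ⟩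
  y ℤ.^ r ℤ.+ (x ℤ.^ r ℤ.+ p r ys)   ∎
  where
  open ≡-Reasoning
  lemma : ∀ a b c → a ℤ.+ (b ℤ.+ c) ≡ b ℤ.+ (a ℤ.+ c)
  lemma = ℤSolver.solve-∀
p-↭ r (↭.trans xs↭ys ys↭zs) = trans (p-↭ r xs↭ys) (p-↭ r ys↭zs)

-- Recovering an integer from sums of pairs

half : ℤ → ℤ
half (+ n)    = + ⌊ n /2⌋
half -[1+ n ] = ℤ.- + ⌊ suc n /2⌋

half-double : ∀ a → half (a ℤ.+ a) ≡ a
half-double (+ n)    = cong +_ (sym (ℕ.n≡⌊n+n/2⌋ n))
half-double -[1+ n ] = cong -[1+_] (sym (ℕ.n≡⌊n+n/2⌋ n))

signed : List ℕ → List ℤ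
signed L = map +_ L ++ map (λ n → ℤ.- + n) L

length-signed : ∀ L → length (signed L) ≡ 2 * length L
length-signed L = trans (length-++ (map +_ L)) (cong₂ ℕ._+_ (length-map +_ L)
  (trans (length-map (λ n → ℤ.- + n) L) (sym (ℕ.+-identityʳ (length L)))))

∈-signed : ∀ {L} i → ∣ i ∣ ∈ L → i ∈ signed L
∈-signed     (+ n)    n∈ = ∈-++⁺ˡ (∈-map⁺ +_ n∈)
∈-signed {L} -[1+ n ] n∈ = ∈-++⁺ʳ (map +_ L) (∈-map⁺ (λ n → ℤ.- + n) n∈)

-- The shape comes from a = ((a+b) + (a+c) - (b+c)) / 2: three pair sums from D determine a.
halfCombinations : List ℤ → List ℤ
halfCombinations D = cartesianProductWith (λ s r → half (s ℤ.- r)) (cartesianProductWith ℤ._+_ D D) D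

length-halfCombinations : ∀ D → length (halfCombinations D) ≡ length D ^ 3
length-halfCombinations D = begin
  length (halfCombinations D)
    ≡⟨ length-cartesianProductWith _ (cartesianProductWith ℤ._+_ D D) D ⟩
  length (cartesianProductWith ℤ._+_ D D) * length D      ≡⟨ cong (_* length D) (length-cartesianProductWith ℤ._+_ D D) ⟩
  length D * length D * length D                          ≡⟨ lemma (length D) ⟩
  length D ^ 3                                            ∎
  where
  open ≡-Reasoning
  lemma : ∀ n → n * n * n ≡ n * (n * (n * 1))
  lemma = solve-∀

∈-halfCombinations : ∀ {D} a b c → a ℤ.+ b ∈ D → a ℤ.+ c ∈ D → b ℤ.+ c ∈ D → a ∈ halfCombinations D
∈-halfCombinations {D} a b c ab∈ ac∈ bc∈ =
  subst (_∈ halfCombinations D) (trans (cong half (lemma a b c)) (half-double a))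
    (∈-cartesianProductWith⁺ (λ s r → half (s ℤ.- r)) (∈-cartesianProductWith⁺ ℤ._+_ ab∈ ac∈) bc∈)
  where
  lemma : ∀ a b c → a ℤ.+ b ℤ.+ (a ℤ.+ c) ℤ.- (b ℤ.+ c) ≡ a ℤ.+ a
  lemma = ℤSolver.solve-∀

-- Distinct positions are compared, so a single 0 is allowed, in contrast to `SumFree`.
NonCancelling : List ℤ → Set
NonCancelling = AllPairs (λ a b → a ℤ.+ b ≢ 0ℤ)

cancellingPair : ∀ xs → (∃[ a ] ∃[ xs′ ] xs ↭ a ∷ ℤ.- a ∷ xs′) ⊎ NonCancelling xs
cancellingPair [] = inj₂ []
cancellingPair (x ∷ xs) with Any.any? (λ b → x ℤ.+ b ℤ.≟ 0ℤ) xs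
... | yes x+b≡0 with b , b∈ , eq ← find x+b≡0 with xs′ , xs↭ ← ∈⇒↭ b∈ =
  inj₁ (x , xs′ , subst (λ c → x ∷ xs ↭ x ∷ c ∷ xs′) (ℤ+.inverseʳ-unique x b eq) (prep x xs↭))
... | no ¬x+b≡0 with cancellingPair xs
...   | inj₂ nc = inj₂ (All.¬Any⇒All¬ xs ¬x+b≡0 ∷ nc)
...   | inj₁ (a , xs′ , xs↭) = inj₁ (a , x ∷ xs′ ,
  ↭-trans (prep x xs↭) (↭-trans (swap x a refl) (prep a (swap x (ℤ.- a) refl))))

nonCancelling-resp-↭ : ∀ {xs ys} → xs ↭ ys → NonCancelling xs → NonCancelling ys
nonCancelling-resp-↭ = AllPairs-resp-↭ (λ {a} {b} a+b≢0 → a+b≢0 ∘ trans (ℤ.+-comm a b))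

sumFree : ∀ {xs} → NonCancelling xs → 0ℤ ∉ xs → SumFree xs
-- The diagonal case is not covered by `NonCancelling`; halving x + x = 0 shows x = 0, which is
-- excluded by `0∉`.
sumFree (x+ ∷ nc) 0∉ x _ (here refl) (here refl) x+x≡0 =
  0∉ (here (sym (trans (sym (half-double x)) (cong half x+x≡0))))
sumFree (x+ ∷ nc) 0∉ x b (here refl) (there b∈)  = All.lookup x+ b∈
sumFree (x+ ∷ nc) 0∉ a x (there a∈)  (here refl) = All.lookup x+ a∈ ∘ trans (ℤ.+-comm x a)
sumFree (x+ ∷ nc) 0∉ a b (there a∈)  (there b∈)  = sumFree nc (0∉ ∘ there) a b a∈ b∈

-- A non-cancelling list contains 0 at most once.
sumFree-tail : ∀ x xs → NonCancelling (x ∷ xs) → ∃[ a ] ∃[ xs′ ] (x ∷ xs ↭ a ∷ xs′ × SumFree xs′)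
sumFree-tail x xs nc with Any.any? (0ℤ ℤ.≟_) (x ∷ xs)
... | no 0∉ = x , xs , refl , (λ a b a∈ b∈ → sumFree nc 0∉ a b (there a∈) (there b∈))
... | yes 0∈ with xs′ , xs↭ ← ∈⇒↭ 0∈ with 0+ ∷ nc′ ← nonCancelling-resp-↭ xs↭ nc =
  0ℤ , xs′ , xs↭ , sumFree nc′ (λ 0∈′ → All.lookup 0+ 0∈′ refl)

sumFree? : ∀ xs → Dec (SumFree xs)
sumFree? xs = map′ (λ all a b a∈ b∈ → All.lookup (All.lookup all a∈) b∈)
  (λ free → All.tabulate λ a∈ → All.tabulate λ b∈ → free _ _ a∈ b∈)
  (All.all? (λ a → All.all? (λ b → ¬? (a ℤ.+ b ℤ.≟ 0ℤ)) xs) xs)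

-- The linear equation gives d = a + b - c, and then c³ + d³ - a³ - b³ = 3(a+b)(a-c)(b-c). Hence c
-- is a or b, and d is the other one.
two-cubes : ∀ a b c d → a ℤ.+ b ≢ 0ℤ →
  p 1 (a ∷ b ∷ []) ≡ p 1 (c ∷ d ∷ []) → p 3 (a ∷ b ∷ []) ≡ p 3 (c ∷ d ∷ []) →
  a ∷ b ∷ [] ⊆ c ∷ d ∷ []
two-cubes a b c d a+b≢0 p₁≡ p₃≡ = subst (λ d → a ∷ b ∷ [] ⊆ c ∷ d ∷ []) (sym d≡) ⊆cd
  where
  open ≡-Reasoning
  expand₁ : ∀ c d → c ℤ.* 1ℤ ℤ.+ (d ℤ.* 1ℤ ℤ.+ 0ℤ) ≡ c ℤ.+ d
  expand₁ = ℤSolver.solve-∀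
  solve-d : ∀ c d → d ≡ c ℤ.+ d ℤ.- c
  solve-d = ℤSolver.solve-∀
  d≡ : d ≡ a ℤ.+ b ℤ.- c
  d≡ = trans (solve-d c d) (cong (ℤ._- c) (trans (sym (expand₁ c d)) (trans (sym p₁≡) (expand₁ a b))))
  factor : ∀ a b c →
    c ℤ.* (c ℤ.* (c ℤ.* 1ℤ)) ℤ.+ ((a ℤ.+ b ℤ.- c) ℤ.* ((a ℤ.+ b ℤ.- c) ℤ.* ((a ℤ.+ b ℤ.- c) ℤ.* 1ℤ)) ℤ.+ 0ℤ)
      ℤ.- (a ℤ.* (a ℤ.* (a ℤ.* 1ℤ)) ℤ.+ (b ℤ.* (b ℤ.* (b ℤ.* 1ℤ)) ℤ.+ 0ℤ)) ≡
    + 3 ℤ.* ((a ℤ.+ b) ℤ.* ((a ℤ.- c) ℤ.* (b ℤ.- c)))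
  factor = ℤSolver.solve-∀
  vanish : + 3 ℤ.* ((a ℤ.+ b) ℤ.* ((a ℤ.- c) ℤ.* (b ℤ.- c))) ≡ 0ℤ
  vanish = begin
    _                                                       ≡⟨ factor a b c ⟨
    p 3 (c ∷ a ℤ.+ b ℤ.- c ∷ []) ℤ.- p 3 (a ∷ b ∷ [])       ≡⟨ cong (λ d → p 3 (c ∷ d ∷ []) ℤ.- p 3 (a ∷ b ∷ [])) d≡ ⟨
    p 3 (c ∷ d ∷ []) ℤ.- p 3 (a ∷ b ∷ [])                   ≡⟨ ℤ.i≡j⇒i-j≡0 (sym p₃≡) ⟩
    0ℤ                                                      ∎
  cancel : ∀ a b → a ℤ.+ b ℤ.- a ≡ b
  cancel = ℤSolver.solve-∀
  roots : a ≡ c ⊎ b ≡ c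
  roots with ℤ.i*j≡0⇒i≡0∨j≡0 (+ 3) vanish
  ... | inj₂ eq with ℤ.i*j≡0⇒i≡0∨j≡0 (a ℤ.+ b) eq
  ...   | inj₁ a+b≡0 = contradiction a+b≡0 a+b≢0
  ...   | inj₂ eq′ with ℤ.i*j≡0⇒i≡0∨j≡0 (a ℤ.- c) eq′
  ...     | inj₁ a-c≡0 = inj₁ (ℤ.i-j≡0⇒i≡j a c a-c≡0)
  ...     | inj₂ b-c≡0 = inj₂ (ℤ.i-j≡0⇒i≡j b c b-c≡0)
  ⊆cd : a ∷ b ∷ [] ⊆ c ∷ a ℤ.+ b ℤ.- c ∷ []
  ⊆cd with roots
  ... | inj₁ refl = λ { (here refl) → here refl ; (there (here refl)) → there (here (sym (cancel a b))) }
  ... | inj₂ refl = λ { (here refl) → there (here (sym (trans (cong (ℤ._- b) (ℤ.+-comm a b)) (cancel b a))))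
                      ; (there (here refl)) → here refl }

-- Covering the solutions of the system

⊆-interval : ∀ {P xs} → All (λ x → ∣ x ∣ ≤ P) xs → xs ⊆ interval P
⊆-interval bounded x∈ = ∈-interval⁺ _ (All.lookup bounded x∈)

-- Lists, unlike vectors of fixed length, can be freely permuted, split and shortened; the exponent
-- is written as in `odd-power`.
SolvesList : ∀ {k} → Vec ℤ k → List ℤ → Set
SolvesList {k} h xs = ∀ (i : Fin k) → p (suc (2 * toℕ i)) xs ≡ lookup h i

solvesList? : ∀ {k} (h : Vec ℤ k) xs → Dec (SolvesList h xs)
solvesList? h xs = all? λ i → p (suc (2 * toℕ i)) xs ℤ.≟ lookup h i

solvesList-resp-↭ : ∀ {k} {h : Vec ℤ k} {xs ys} → xs ↭ ys → SolvesList h xs → SolvesList h ys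
solvesList-resp-↭ xs↭ys solves i = trans (sym (p-↭ (suc (2 * toℕ i)) xs↭ys)) (solves i)

-- All exponents are odd, so a and -a contribute nothing and the right-hand side h stays the same.
solvesList-cancel : ∀ {k} {h : Vec ℤ k} a xs → SolvesList h (a ∷ ℤ.- a ∷ xs) → SolvesList h xs
solvesList-cancel a xs solves i = trans (sym (begin
  a ℤ.^ r ℤ.+ ((ℤ.- a) ℤ.^ r ℤ.+ p r xs)    ≡⟨ cong (λ b → a ℤ.^ r ℤ.+ (b ℤ.+ p r xs)) (odd-power (toℕ i) a) ⟩
  a ℤ.^ r ℤ.+ (ℤ.- (a ℤ.^ r) ℤ.+ p r xs)    ≡⟨ lemma (a ℤ.^ r) (p r xs) ⟩
  p r xs                                    ∎)) (solves i)
  where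
  open ≡-Reasoning
  r = suc (2 * toℕ i)
  lemma : ∀ a s → a ℤ.+ (ℤ.- a ℤ.+ s) ≡ s
  lemma = ℤSolver.solve-∀

solvesList-agree : ∀ {k} {h : Vec ℤ k} {xs ys} → SolvesList h xs → SolvesList h ys →
  ∀ j → j < k → p (suc (2 * j)) xs ≡ p (suc (2 * j)) ys
solvesList-agree {xs = xs} {ys} solves-xs solves-ys j j<k =
  subst (λ i → p (suc (2 * i)) xs ≡ p (suc (2 * i)) ys) (toℕ-fromℕ< j<k)
    (trans (solves-xs (fromℕ< j<k)) (sym (solves-ys (fromℕ< j<k))))

-- The assumption h ≠ 0 enters as `no-[]`. The size allowed in `divisors` is that of the square of
-- `pairs gap y` for at most k+1 entries: their pair sums are at most 2P, and `pairs-≤` supplies the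
-- exponent (k+1)².
module Covering {k} (2≤k : 2 ≤ k) (h : Vec ℤ k) (no-[] : ¬ SolvesList h [])
  (P : ℕ) .{{_ : NonZero P}} (G : ℕ)
  (divisors : ∀ N .{{_ : NonZero N}} → N ≤ (2 * P) ^ (2 * (suc k * suc k)) →
              ∃[ L ] (ContainsDivisors N L × length L ≤ G)) where

  Bounded : List ℤ → Set
  Bounded = All (λ x → ∣ x ∣ ≤ P)

  -- Z bounds the length of `halfCombinations (signed L)` for a divisor list L of length at most G.
  W Z : ℕ
  W = length (interval P)
  Z = (2 * G) ^ 3

  module _ (t : ℕ) (2≤t : 2 ≤ t) (t≤k : t ≤ k) where

    module _ (y : List ℤ) (|y| : length y ≡ suc t) (y-bounded : Bounded y) (y-free : SumFree y) where

      private
        N = pairs gap y * pairs gap y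

        N≢0 : NonZero N
        N≢0 = ℕ.m*n≢0 (pairs gap y) (pairs gap y) {{D≢0}} {{D≢0}}
          where
          D≢0 = ℕ.≢-nonZero (pairs-nonZero gap y (gap≢0 y-free))

        gap≤2P : ∀ {a b} → a ∈ y → b ∈ y → gap a b ≤ 2 * P
        gap≤2P {a} {b} a∈ b∈ = begin
          ∣ a ℤ.+ b ∣             ≤⟨ ℤ.∣i+j∣≤∣i∣+∣j∣ a b ⟩
          ∣ a ∣ ℕ.+ ∣ b ∣         ≤⟨ ℕ.+-mono-≤ (All.lookup y-bounded a∈) (All.lookup y-bounded b∈) ⟩
          P ℕ.+ P                 ≡⟨ cong (P ℕ.+_) (ℕ.+-identityʳ P) ⟨
          2 * P                   ∎
          where open ℕ.≤-Reasoning

        instance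
          2P≢0 : NonZero (2 * P)
          2P≢0 = ℕ.m*n≢0 2 P

        N≤ : N ≤ (2 * P) ^ (2 * (suc k * suc k))
        N≤ = begin
          N                                               ≤⟨ ℕ.*-mono-≤ D≤ D≤ ⟩
          (2 * P) ^ (n * n) * (2 * P) ^ (n * n)           ≡⟨ ℕ.^-distribˡ-+-* (2 * P) (n * n) (n * n) ⟨
          (2 * P) ^ (n * n ℕ.+ n * n)                     ≡⟨ cong (λ e → (2 * P) ^ (n * n ℕ.+ e)) (ℕ.+-identityʳ (n * n)) ⟨
          (2 * P) ^ (2 * (n * n))                         ≤⟨ ℕ.^-monoʳ-≤ (2 * P) (ℕ.*-monoʳ-≤ 2 (ℕ.*-mono-≤ n≤ n≤)) ⟩
          (2 * P) ^ (2 * (suc k * suc k))                 ∎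
          where
          open ℕ.≤-Reasoning
          n = length y
          n≤ : n ≤ suc k
          n≤ = subst (_≤ suc k) (sym |y|) (s≤s t≤k)
          D≤ : pairs gap y ≤ (2 * P) ^ (n * n)
          D≤ = pairs-≤ gap (2 * P) y gap≤2P

        L = proj₁ (divisors N {{N≢0}} N≤)
        L∋ : ContainsDivisors N L
        L∋ = proj₁ (proj₂ (divisors N {{N≢0}} N≤))

      -- Either v ⊆ y, or the pair sums of v divide N and therefore lie in `signed L`. As t ≥ 2,
      -- each entry a of v has two further entries b and c beside it, and the three sums recover a.
      sharedSupport : ∃[ z ] (length z ≤ suc t ℕ.+ Z ×
        (∀ v → length v ≡ suc t → SumFree v →
         (∀ j → j < t → p (suc (2 * j)) v ≡ p (suc (2 * j)) y) → v ⊆ z))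
      sharedSupport = y ++ halfCombinations (signed L) , |z|≤ , contains
        where
        |z|≤ : length (y ++ halfCombinations (signed L)) ≤ suc t ℕ.+ Z
        |z|≤ = begin
          length (y ++ halfCombinations (signed L))              ≡⟨ length-++ y ⟩
          length y ℕ.+ length (halfCombinations (signed L))      ≡⟨ cong₂ ℕ._+_ |y| (length-halfCombinations (signed L)) ⟩
          suc t ℕ.+ length (signed L) ^ 3                        ≡⟨ cong (λ n → suc t ℕ.+ n ^ 3) (length-signed L) ⟩
          suc t ℕ.+ (2 * length L) ^ 3                           ≤⟨ ℕ.+-monoʳ-≤ (suc t) (ℕ.^-monoˡ-≤ 3
                                                                      (ℕ.*-monoʳ-≤ 2 (proj₂ (proj₂ (divisors N {{N≢0}} N≤))))) ⟩
          suc t ℕ.+ Z                                            ∎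
          where open ℕ.≤-Reasoning

        contains : ∀ v → length v ≡ suc t → SumFree v →
          (∀ j → j < t → p (suc (2 * j)) v ≡ p (suc (2 * j)) y) →
          v ⊆ y ++ halfCombinations (signed L)
        contains v |v| v-free p≡ {a} a∈ with odd-power-sums⇒⊆-or-equal-pairs t v y |v| |y| v-free y-free p≡
        ... | inj₁ v⊆y = ∈-++⁺ˡ (v⊆y a∈)
        ... | inj₂ eq  = ∈-++⁺ʳ y (step (∈⇒↭ a∈))
          where
          sum∈ : ∀ b c → gap b c ∣ pairs gap v → b ℤ.+ c ∈ signed L
          sum∈ b c gap∣ = ∈-signed (b ℤ.+ c) (L∋ (subst (gap b c ∣_) eq (∣-trans gap∣ (m∣m*n (pairs gap v)))))
          combine : ∀ v′ → length v′ ≡ t → AllPairs (λ b c → gap b c ∣ pairs gap v) (a ∷ v′) →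
            a ∈ halfCombinations (signed L)
          combine []          0≡t _ = contradiction (subst (2 ≤_) (sym 0≡t) 2≤t) λ ()
          combine (_ ∷ [])    1≡t _ = contradiction (subst (2 ≤_) (sym 1≡t) 2≤t) λ { (s≤s ()) }
          combine (b ∷ c ∷ _) _ ((ab ∷ ac ∷ _) ∷ (bc ∷ _) ∷ _) =
            ∈-halfCombinations a b c (sum∈ a b ab) (sum∈ a c ac) (sum∈ b c bc)
          step : ∃[ v′ ] v ↭ a ∷ v′ → a ∈ halfCombinations (signed L)
          step (v′ , v↭) = combine v′ (ℕ.suc-injective (trans (sym (↭-length v↭)) |v|))
            (AllPairs-resp-↭ (λ {b} {c} → subst (_∣ pairs gap v) (gap-sym b c)) v↭ (all-∣pairs gap v))

    -- A finite search looks for one sum-free completion y of w. If there is none, the empty support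
    -- serves; otherwise the contribution of w cancels and every completion is compared with this y.
    tailSupport : ∀ w → ∃[ z ] (length z ≤ suc t ℕ.+ Z ×
      (∀ v → length v ≡ suc t → Bounded v → SumFree v → SolvesList h (w ++ v) → v ⊆ z))
    tailSupport w with Any.any? (λ y → sumFree? y ×-dec solvesList? h (w ++ y)) (words (suc t) (interval P))
    ... | no none = [] , z≤n , λ v |v| v-bounded v-free v-solves →
      contradiction (v-free , v-solves)
        (All.lookup (All.¬Any⇒All¬ _ none) (∈-words⁺ v |v| (⊆-interval v-bounded)))
    ... | yes some with y , y∈ , y-free , y-solves ← find some
                   with |y| , y⊆ ← ∈-words⁻ (suc t) y∈ =
      let z , |z| , contains = sharedSupport y |y| (All.tabulate (λ a∈ → ∈-interval⁻ _ (y⊆ a∈))) y-free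
      in z , |z| , λ v |v| _ v-free v-solves → contains v |v| v-free (λ j j<t →
           ℤ+.∙-cancelˡ (p (suc (2 * j)) w) _ _ (begin
             p (suc (2 * j)) w ℤ.+ p (suc (2 * j)) v   ≡⟨ p-++ (suc (2 * j)) w v ⟨
             p (suc (2 * j)) (w ++ v)
               ≡⟨ solvesList-agree {h = h} {w ++ v} {w ++ y} v-solves y-solves j (ℕ.<-≤-trans j<t t≤k) ⟩
             p (suc (2 * j)) (w ++ y)                  ≡⟨ p-++ (suc (2 * j)) w y ⟩
             p (suc (2 * j)) w ℤ.+ p (suc (2 * j)) y   ∎))
      where open ≡-Reasoning

  record Cover (S : List ℤ → Set) (B z : ℕ) : Set where
    field
      supports : List (List ℤ)
      size     : length supports ≤ B
      width    : ∀ {s} → s ∈ supports → length s ≤ z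
      covers   : ∀ {xs} → S xs → ∃[ s ] (s ∈ supports × xs ⊆ s)

  Solution : ℕ → List ℤ → Set
  Solution t xs = length xs ≡ 2 * t × Bounded xs × SolvesList h xs

  -- Since k ≥ 2, the equations of degrees 1 and 3 are both present, and `two-cubes` makes any one
  -- solution a support for all. The width carries Z to match the shape of the general case.
  cover-pair : Cover (λ xs → NonCancelling xs × Solution 1 xs) 1 (2 ℕ.+ Z)
  cover-pair with Any.any? (solvesList? h) (words 2 (interval P))
  ... | no none = record
    { supports = [] ; size = z≤n ; width = λ ()
    ; covers = λ {xs} (_ , |xs| , bounded , solves) → contradiction solves
        (All.lookup (All.¬Any⇒All¬ _ none) (∈-words⁺ xs |xs| (⊆-interval bounded))) }
  ... | yes some with find some
  ...   | y , y∈ , y-solves = record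
    { supports = [ y ] ; size = s≤s z≤n
    ; width  = λ { (here refl) → subst (_≤ 2 ℕ.+ Z) (sym |y|) (ℕ.m≤m+n 2 Z) }
    ; covers = λ {xs} (nc , |xs| , _ , solves) → y , here refl , pair⊆ xs y |xs| |y| nc solves y-solves }
    where
    |y| : length y ≡ 2
    |y| = proj₁ (∈-words⁻ 2 {interval P} y∈)
    pair⊆ : ∀ xs ys → length xs ≡ 2 → length ys ≡ 2 → NonCancelling xs →
      SolvesList h xs → SolvesList h ys → xs ⊆ ys
    pair⊆ xs@(a ∷ b ∷ []) ys@(c ∷ d ∷ []) refl refl ((a+b≢0 ∷ _) ∷ _) xs-solves ys-solves =
      two-cubes a b c d a+b≢0 (agree 0 (ℕ.≤-trans (s≤s z≤n) 2≤k)) (agree 1 2≤k)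
      where
      agree = solvesList-agree {h = h} {xs} {ys} xs-solves ys-solves

  cover-nonCancelling : ∀ u → suc u ≤ k →
    Cover (λ xs → NonCancelling xs × Solution (suc u) xs) (W ^ u) (2 * suc u ℕ.+ Z)
  cover-nonCancelling zero    _   = cover-pair
  cover-nonCancelling (suc u) t≤k = record
    { supports = map support (words (suc u) (interval P))
    ; size     = ℕ.≤-reflexive (trans (length-map support (words (suc u) (interval P))) (length-words (suc u) (interval P)))
    ; width    = width
    ; covers   = λ {xs} (nc , |xs| , bounded , solves) → covers xs nc |xs| bounded solves
    }
    where
    -- The fixed part w has suc u = t - 1 entries and leaves t + 1, so a support has length at most
    -- (t-1) + (t+1) + Z.
    t = suc (suc u)
    tail : ∀ w → _
    tail = tailSupport t (s≤s (s≤s z≤n)) t≤k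
    support : List ℤ → List ℤ
    support w = w ++ proj₁ (tail w)

    width : ∀ {s} → s ∈ map support (words (suc u) (interval P)) → length s ≤ 2 * t ℕ.+ Z
    width s∈ with w , w∈ , refl ← ∈-map⁻ support s∈ = begin
      length (w ++ proj₁ (tail w))              ≡⟨ length-++ w ⟩
      length w ℕ.+ length (proj₁ (tail w))
        ≤⟨ ℕ.+-mono-≤ (ℕ.≤-reflexive (proj₁ (∈-words⁻ (suc u) w∈))) (proj₁ (proj₂ (tail w))) ⟩
      suc u ℕ.+ (suc t ℕ.+ Z)                   ≡⟨ lemma u Z ⟩
      2 * t ℕ.+ Z                               ∎
      where
      open ℕ.≤-Reasoning
      lemma : ∀ u z → suc u ℕ.+ (suc (suc (suc u)) ℕ.+ z) ≡ 2 * suc (suc u) ℕ.+ z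
      lemma = solve-∀

    covers : ∀ xs → NonCancelling xs → length xs ≡ 2 * t → Bounded xs → SolvesList h xs →
      ∃[ s ] (s ∈ map support (words (suc u) (interval P)) × xs ⊆ s)
    covers (x ∷ xs) nc |xs| bounded solves with a , xs′ , xs↭ , free ← sumFree-tail x xs nc =
      support w , ∈-map⁺ support (∈-words⁺ w |w| (⊆-interval w-bounded)) , λ x∈ →
        [ ∈-++⁺ˡ , (∈-++⁺ʳ w ∘ proj₂ (proj₂ (tail w)) v |v| v-bounded v-free
            (solvesList-resp-↭ {h = h} xs↭w++v solves)) ]′ (∈-++⁻ w (∈-resp-↭ xs↭w++v x∈))
      where
      -- The entry a from `sumFree-tail` is 0 whenever 0 occurs; putting it into w leaves v
      -- sum-free.
      w = a ∷ take u xs′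
      v = drop u xs′
      split : xs′ ≡ take u xs′ ++ v
      split = sym (take++drop≡id u xs′)
      xs↭w++v : x ∷ xs ↭ w ++ v
      xs↭w++v = subst (λ ys → x ∷ xs ↭ a ∷ ys) split xs↭
      |xs′| : length xs′ ≡ u ℕ.+ suc t
      |xs′| = ℕ.suc-injective (trans (sym (↭-length xs↭)) (trans |xs| (lemma u)))
        where
        lemma : ∀ u → 2 * suc (suc u) ≡ suc (u ℕ.+ suc (suc (suc u)))
        lemma = solve-∀
      |w| : length w ≡ suc u
      |w| = cong suc (trans (length-take u xs′)
        (ℕ.m≤n⇒m⊓n≡m (subst (u ≤_) (sym |xs′|) (ℕ.m≤m+n u (suc t)))))
      |v| : length v ≡ suc t
      |v| = trans (length-drop u xs′) (trans (cong (_∸ u) |xs′|) (ℕ.m+n∸m≡n u (suc t)))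
      all-bounded : Bounded (w ++ v)
      all-bounded = All-resp-↭ xs↭w++v bounded
      w-bounded : Bounded w
      w-bounded = All.++⁻ˡ w all-bounded
      v-bounded : Bounded v
      v-bounded = All.++⁻ʳ w all-bounded
      v⊆ : v ⊆ xs′
      v⊆ x∈ = subst (_ ∈_) (sym split) (∈-++⁺ʳ (take u xs′) x∈)
      v-free : SumFree v
      v-free a b a∈ b∈ = free a b (v⊆ a∈) (v⊆ b∈)

  -- The solution of count (u+1) = W · count u + W^u with count 0 = 0: the first term chooses a
  -- cancelling pair and recurses, the second covers the non-cancelling solutions.
  count : ℕ → ℕ
  count zero    = 0
  count (suc u) = suc u * W ^ u

  cover : ∀ t → t ≤ k → Cover (Solution t) (count t) (2 * t ℕ.+ Z)
  -- Zero supports suffice here because h ≠ 0. A single one would grow to W^t after t cancellations,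
  -- one power of P too many.
  cover zero t≤k = record
    { supports = [] ; size = z≤n ; width = λ ()
    ; covers = λ { {[]} (_ , _ , solves) → contradiction solves no-[] } }
  cover (suc u) t≤k = record
    { supports = cancelling ++ C₂.supports
    ; size     = size
    ; width    = width
    ; covers   = λ {xs} sol → covers xs sol
    }
    where
    module C₁ = Cover (cover u (ℕ.<⇒≤ t≤k))
    module C₂ = Cover (cover-nonCancelling u t≤k)
    withPair : ℤ → List ℤ → List ℤ
    withPair a s = a ∷ ℤ.- a ∷ s
    cancelling : List (List ℤ)
    cancelling = cartesianProductWith withPair (interval P) C₁.supports

    count-suc : ∀ u → W * count u ℕ.+ W ^ u ≡ suc u * W ^ u
    count-suc zero    = cong (ℕ._+ 1) (ℕ.*-zeroʳ W)
    count-suc (suc u) = lemma W (suc u) (W ^ u)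
      where
      lemma : ∀ w u x → w * (u * x) ℕ.+ w * x ≡ w * x ℕ.+ u * (w * x)
      lemma = solve-∀

    size : length (cancelling ++ C₂.supports) ≤ suc u * W ^ u
    size = begin
      length (cancelling ++ C₂.supports)                   ≡⟨ length-++ cancelling ⟩
      length cancelling ℕ.+ length C₂.supports             ≡⟨ cong (ℕ._+ length C₂.supports)
                                                                (length-cartesianProductWith withPair (interval P) C₁.supports) ⟩
      W * length C₁.supports ℕ.+ length C₂.supports        ≤⟨ ℕ.+-mono-≤ (ℕ.*-monoʳ-≤ W C₁.size) C₂.size ⟩
      W * count u ℕ.+ W ^ u                                ≡⟨ count-suc u ⟩
      suc u * W ^ u                                        ∎
      where open ℕ.≤-Reasoning

    width : ∀ {s} → s ∈ cancelling ++ C₂.supports → length s ≤ 2 * suc u ℕ.+ Z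
    width s∈ with ∈-++⁻ cancelling s∈
    ... | inj₂ s∈₂ = C₂.width s∈₂
    ... | inj₁ s∈₁ with a , s , _ , s∈′ , refl ← ∈-cartesianProductWith⁻ withPair (interval P) C₁.supports s∈₁ =
      subst (2 ℕ.+ length s ≤_) (cong (ℕ._+ Z) (sym (ℕ.*-suc 2 u))) (s≤s (s≤s (C₁.width s∈′)))

    covers : ∀ xs → Solution (suc u) xs → ∃[ s ] (s ∈ cancelling ++ C₂.supports × xs ⊆ s)
    covers xs sol@(|xs| , bounded , solves) with cancellingPair xs
    ... | inj₂ nc with s , s∈ , xs⊆s ← C₂.covers (nc , sol) = s , ∈-++⁺ʳ cancelling s∈ , xs⊆s
    ... | inj₁ (a , xs′ , xs↭) with a-bounded ∷ _ ∷ bounded′ ← All-resp-↭ xs↭ bounded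
        with s , s∈ , xs′⊆s ← C₁.covers
          ( ℕ.suc-injective (ℕ.suc-injective (trans (sym (↭-length xs↭)) (trans |xs| (ℕ.*-suc 2 u))))
          , bounded′ , solvesList-cancel {h = h} a xs′ (solvesList-resp-↭ {h = h} xs↭ solves))
        = withPair a s
        , ∈-++⁺ˡ (∈-cartesianProductWith⁺ withPair (∈-interval⁺ a a-bounded) s∈)
        , λ x∈ → extend (∈-resp-↭ xs↭ x∈)
      where
      extend : a ∷ ℤ.- a ∷ xs′ ⊆ withPair a s
      extend (here x≡a)           = here x≡a
      extend (there (here x≡-a))  = there (here x≡-a)
      extend (there (there x∈))   = there (there (xs′⊆s x∈))

-- Counting

powerSum≡p : ∀ {s} r (xs : Vec ℤ s) → powerSum r xs ≡ p r (Vec.toList xs)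
powerSum≡p r Vec.[]       = refl
powerSum≡p r (x Vec.∷ xs) = cong (λ s → x ℤ.^ r ℤ.+ s) (powerSum≡p r xs)

solves⇒solvesList : ∀ {s k} {h : Vec ℤ k} (xs : Vec ℤ s) → Solves h xs → SolvesList h (Vec.toList xs)
solves⇒solvesList xs solves i = trans (sym (powerSum≡p (suc (2 * toℕ i)) xs))
  -- With n = toℕ i, the exponent 2 * suc n ∸ 1 computes to n + suc (n + 0), whereas suc (2 * n) is
  -- suc (n + (n + 0)).
  (trans (cong (λ r → powerSum r xs) (sym (ℕ.+-suc (toℕ i) (toℕ i ℕ.+ 0)))) (solves i))

solvesList-[]⇒≡0 : ∀ {k} {h : Vec ℤ k} → SolvesList h [] → h ≡ Vec.replicate k 0ℤ
solvesList-[]⇒≡0 {k} {h} solves = begin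
  h                                              ≡⟨ Vec.tabulate∘lookup h ⟨
  Vec.tabulate (lookup h)                        ≡⟨ Vec.tabulate-cong solves ⟨
  Vec.tabulate (λ _ → 0ℤ)                        ≡⟨ Vec.tabulate-cong (λ i → Vec.lookup-replicate i 0ℤ) ⟨
  Vec.tabulate (lookup (Vec.replicate k 0ℤ))     ≡⟨ Vec.tabulate∘lookup (Vec.replicate k 0ℤ) ⟩
  Vec.replicate k 0ℤ                             ∎
  where open ≡-Reasoning

length-interval : ∀ P .{{_ : NonZero P}} → length (interval P) ≤ 3 * P
length-interval P = begin
  length (interval P)
    ≡⟨ length-++ (map +_ (upTo (suc P))) ⟩
  length (map +_ (upTo (suc P))) ℕ.+ length (map -[1+_] (upTo P))
    ≡⟨ cong₂ ℕ._+_ (trans (length-map +_ (upTo (suc P))) (length-upTo (suc P)))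
                   (trans (length-map -[1+_] (upTo P)) (length-upTo P)) ⟩
  1 ℕ.+ P ℕ.+ P
    ≤⟨ ℕ.+-monoˡ-≤ P (ℕ.+-monoˡ-≤ P (ℕ.>-nonZero⁻¹ P)) ⟩
  P ℕ.+ P ℕ.+ P
    ≡⟨ lemma P ⟩
  3 * P ∎
  where
  open ℕ.≤-Reasoning
  lemma : ∀ n → n ℕ.+ n ℕ.+ n ≡ 3 * n
  lemma = solve-∀

module _ {k} (2≤k : 2 ≤ k) (h : Vec ℤ k) (h≢0 : h ≢ Vec.replicate k 0ℤ)
  (P : ℕ) .{{_ : NonZero P}} (G : ℕ)
  (divisors : ∀ N .{{_ : NonZero N}} → N ≤ (2 * P) ^ (2 * (suc k * suc k)) →
              ∃[ L ] (ContainsDivisors N L × length L ≤ G)) where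

  open Covering 2≤k h (h≢0 ∘ solvesList-[]⇒≡0) P G divisors

  -- Every solution is a word of length 2t over one of the supports; the order and multiplicity
  -- ignored by the covering are paid for here.
  U-≤-count : ∀ t → t ≤ k → U (2 * t) k P h ≤ count t * (2 * t ℕ.+ Z) ^ (2 * t)
  U-≤-count t t≤k = begin
    length F                                              ≡⟨ length-map Vec.toList F ⟨
    length (map Vec.toList F)                             ≤⟨ Unique-⊆⇒length-≤ unique F⊆ ⟩
    length (concatMap (words (2 * t)) supports)           ≤⟨ length-concatMap-≤ (words (2 * t)) supports words-≤ ⟩
    length supports * (2 * t ℕ.+ Z) ^ (2 * t)             ≤⟨ ℕ.*-monoˡ-≤ _ size ⟩
    count t * (2 * t ℕ.+ Z) ^ (2 * t)                     ∎
    where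
    open ℕ.≤-Reasoning
    open Cover (cover t t≤k)
    F : List (Vec ℤ (2 * t))
    F = filter (solves? h) (box (2 * t) P)

    toList-inj : ∀ {xs ys : Vec ℤ (2 * t)} → Vec.toList xs ≡ Vec.toList ys → xs ≡ ys
    toList-inj {xs} {ys} eq = trans (sym (Vec.cast-is-id refl xs)) (Vec.toList-injective refl xs ys eq)

    unique : Unique (map Vec.toList F)
    unique = Unique.map⁺ toList-inj (Unique.filter⁺ (solves? h) (box-unique (2 * t) P))

    F⊆ : map Vec.toList F ⊆ concatMap (words (2 * t)) supports
    F⊆ xs∈
      with xs , xs∈F , refl ← ∈-map⁻ Vec.toList xs∈
      with xs∈box , solves ← ∈-filter⁻ (solves? h) {xs = box (2 * t) P} xs∈F
      with s , s∈ , xs⊆s ← covers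
             (Vec.length-toList xs , Vec.toList⁺ (∈-box⁻ xs∈box) , solves⇒solvesList {h = h} xs solves)
      = ∈-concatMap⁺ (words (2 * t)) (lose s∈ (∈-words⁺ (Vec.toList xs) (Vec.length-toList xs) xs⊆s))

    words-≤ : ∀ {s} → s ∈ supports → length (words (2 * t) s) ≤ (2 * t ℕ.+ Z) ^ (2 * t)
    words-≤ {s} s∈ = subst (_≤ (2 * t ℕ.+ Z) ^ (2 * t)) (sym (length-words (2 * t) s))
      (ℕ.^-monoˡ-≤ (2 * t) (width s∈))

  -- Here t = u + 1, so P^u is the main term. Dependence on t is replaced by dependence on k to make
  -- the constant uniform, and G ≥ 1 allows 2k + 8G³ ≤ (2k+8)G³.
  U-≤ : 1 ≤ G → ∀ u → suc u ≤ k →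
    U (2 * suc u) k P h ≤ k * 3 ^ k * (2 * k ℕ.+ 8) ^ (2 * k) * (P ^ u * G ^ (3 * (2 * k)))
  U-≤ 1≤G u t≤k = begin
    U (2 * suc u) k P h
      ≤⟨ U-≤-count (suc u) t≤k ⟩
    suc u * W ^ u * (2 * suc u ℕ.+ Z) ^ (2 * suc u)
      ≤⟨ ℕ.*-mono-≤ (ℕ.*-mono-≤ t≤k W^u≤) width^≤ ⟩
    k * (3 ^ k * P ^ u) * (X ^ (2 * k) * G ^ (3 * (2 * k)))
      ≡⟨ lemma k (3 ^ k) (P ^ u) (X ^ (2 * k)) (G ^ (3 * (2 * k))) ⟩
    k * 3 ^ k * X ^ (2 * k) * (P ^ u * G ^ (3 * (2 * k))) ∎
    where
    open ℕ.≤-Reasoning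
    X = 2 * k ℕ.+ 8
    lemma : ∀ a b c d e → a * (b * c) * (d * e) ≡ a * b * d * (c * e)
    lemma = solve-∀
    instance
      G≢0 : NonZero G
      G≢0 = ℕ.>-nonZero 1≤G
      X≢0 : NonZero (X * G ^ 3)
      X≢0 = ℕ.m*n≢0 X (G ^ 3) {{ℕ.>-nonZero (ℕ.≤-trans (s≤s z≤n) (ℕ.m≤n+m 8 (2 * k)))}} {{ℕ.m^n≢0 G 3}}
    W^u≤ : W ^ u ≤ 3 ^ k * P ^ u
    W^u≤ = begin
      W ^ u             ≤⟨ ℕ.^-monoˡ-≤ u (length-interval P) ⟩
      (3 * P) ^ u       ≡⟨ ^-distribʳ-* u 3 P ⟩
      3 ^ u * P ^ u     ≤⟨ ℕ.*-monoˡ-≤ (P ^ u) (ℕ.^-monoʳ-≤ 3 (ℕ.<⇒≤ t≤k)) ⟩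
      3 ^ k * P ^ u     ∎
    width≤ : 2 * suc u ℕ.+ Z ≤ X * G ^ 3
    width≤ = begin
      2 * suc u ℕ.+ (2 * G) ^ 3         ≤⟨ ℕ.+-monoˡ-≤ ((2 * G) ^ 3) (ℕ.*-monoʳ-≤ 2 t≤k) ⟩
      2 * k ℕ.+ (2 * G) ^ 3             ≡⟨ cong (2 * k ℕ.+_) (^-distribʳ-* 3 2 G) ⟩
      2 * k ℕ.+ 8 * G ^ 3               ≤⟨ ℕ.+-monoˡ-≤ (8 * G ^ 3) (ℕ.m≤m*n (2 * k) (G ^ 3) {{ℕ.m^n≢0 G 3}}) ⟩
      2 * k * G ^ 3 ℕ.+ 8 * G ^ 3       ≡⟨ ℕ.*-distribʳ-+ (G ^ 3) (2 * k) 8 ⟨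
      X * G ^ 3                         ∎
    width^≤ : (2 * suc u ℕ.+ Z) ^ (2 * suc u) ≤ X ^ (2 * k) * G ^ (3 * (2 * k))
    width^≤ = begin
      (2 * suc u ℕ.+ Z) ^ (2 * suc u)       ≤⟨ ℕ.^-monoˡ-≤ (2 * suc u) width≤ ⟩
      (X * G ^ 3) ^ (2 * suc u)             ≤⟨ ℕ.^-monoʳ-≤ (X * G ^ 3) (ℕ.*-monoʳ-≤ 2 t≤k) ⟩
      (X * G ^ 3) ^ (2 * k)                 ≡⟨ ^-distribʳ-* (2 * k) X (G ^ 3) ⟩
      X ^ (2 * k) * (G ^ 3) ^ (2 * k)       ≡⟨ cong (X ^ (2 * k) *_) (ℕ.^-*-assoc G 3 (2 * k)) ⟩
      X ^ (2 * k) * G ^ (3 * (2 * k))       ∎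

-- The divisor bound enters `U-≤` as G^m with m = 6k. Requesting it with exponent m·d makes the d-th
-- power of G^m an O(P), so the total loss is P^(1/d).
U^d-≤ : ∀ k → 2 ≤ k → ∀ d .{{_ : NonZero d}} →
  ∃[ C ] (∀ (h : Vec ℤ k) → h ≢ Vec.replicate k 0ℤ → ∀ u → suc u ≤ k → ∀ P .{{_ : NonZero P}} →
    U (2 * suc u) k P h ^ d ≤ C ^ d * P ^ (u * d ℕ.+ 1))
U^d-≤ k 2≤k d = K * suc C , bound
  where
  E = 2 * (suc k * suc k)
  m = 3 * (2 * k)
  K = k * 3 ^ k * (2 * k ℕ.+ 8) ^ (2 * k)
  instance
    k≢0 : NonZero k
    k≢0 = ℕ.>-nonZero (ℕ.<⇒≤ 2≤k)
    2k≢0 : NonZero (2 * k)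
    2k≢0 = ℕ.m*n≢0 2 k
    m≢0 : NonZero m
    m≢0 = ℕ.m*n≢0 3 (2 * k)
    md≢0 : NonZero (m * d)
    md≢0 = ℕ.m*n≢0 m d
  uniform = uniform-divisorBound (m * d) E (2 ^ E)
  C = proj₁ uniform

  bound : ∀ (h : Vec ℤ k) → h ≢ Vec.replicate k 0ℤ → ∀ u → suc u ≤ k → ∀ P .{{_ : NonZero P}} →
    U (2 * suc u) k P h ^ d ≤ (K * suc C) ^ d * P ^ (u * d ℕ.+ 1)
  bound h h≢0 u t≤k P with proj₂ uniform P
  ... | G , 1≤G , G^md≤ , divisors = begin
    U (2 * suc u) k P h ^ d                   ≤⟨ ℕ.^-monoˡ-≤ d (U-≤ 2≤k h h≢0 P G divisors′ 1≤G u t≤k) ⟩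
    (K * (P ^ u * G ^ m)) ^ d                 ≡⟨ ^-distribʳ-* d K (P ^ u * G ^ m) ⟩
    K ^ d * (P ^ u * G ^ m) ^ d               ≡⟨ cong (K ^ d *_) (^-distribʳ-* d (P ^ u) (G ^ m)) ⟩
    K ^ d * ((P ^ u) ^ d * (G ^ m) ^ d)       ≡⟨ cong₂ (λ x y → K ^ d * (x * y)) (ℕ.^-*-assoc P u d) (ℕ.^-*-assoc G m d) ⟩
    K ^ d * (P ^ (u * d) * G ^ (m * d))       ≤⟨ ℕ.*-monoʳ-≤ (K ^ d) (ℕ.*-monoʳ-≤ (P ^ (u * d)) G≤) ⟩
    K ^ d * (P ^ (u * d) * (suc C ^ d * P))   ≡⟨ lemma (K ^ d) (P ^ (u * d)) (suc C ^ d) P ⟩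
    K ^ d * suc C ^ d * (P ^ (u * d) * (P * 1)) ≡⟨ cong₂ _*_ (^-distribʳ-* d K (suc C)) (ℕ.^-distribˡ-+-* P (u * d) 1) ⟨
    (K * suc C) ^ d * P ^ (u * d ℕ.+ 1)       ∎
    where
    open ℕ.≤-Reasoning
    lemma : ∀ a b c p → a * (b * (c * p)) ≡ a * c * (b * (p * 1))
    lemma = solve-∀
    G≤ : G ^ (m * d) ≤ suc C ^ d * P
    G≤ = ℕ.≤-trans G^md≤ (ℕ.*-monoˡ-≤ P (ℕ.≤-trans (ℕ.n≤1+n C) (n≤n^ d (suc C))))
    divisors′ : ∀ N .{{_ : NonZero N}} → N ≤ (2 * P) ^ E → ∃[ L ] (ContainsDivisors N L × length L ≤ G)
    divisors′ N N≤ = divisors N (subst (N ≤_) (^-distribʳ-* E 2 P) N≤)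

≤·^-intro : ∀ {u C P} e {a d} → ↥ e ≡ + a → ↧ₙ e ≡ d → u ^ d ≤ C ^ d * P ^ a → u ≤ C · P ^ e
≤·^-intro e eq refl u^d≤ with ↥ e | eq
... | _ | refl = u^d≤

corollary1p7 : ∀ (k : ℕ) → 2 ℕ.≤ k → ∀ (ε : ℚᵘ) → 0ℚᵘ ℚᵘ.< ε →
    ∃[ C ] (∀ (h : Vec ℤ k) → h ≢ replicate k 0ℤ →
    ∀ (t : ℕ) → 1 ℕ.≤ t → t ℕ.≤ k →
    ∀ (P : ℕ) → 1 ℕ.≤ P →
    U (2 ℕ.* t) k P h ≤ C · P ^ ((+ t / 1) ℚᵘ.- 1ℚᵘ) ℚᵘ.+ ε)
corollary1p7 k 2≤k (mkℚᵘ (+ 0)       d-1) (*<* (ℤ.+<+ ()))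
corollary1p7 k 2≤k (mkℚᵘ (+ suc a)   d-1) _ = C , bound
  where
  d = suc d-1
  ε = mkℚᵘ (+ suc a) d-1
  C = proj₁ (U^d-≤ k 2≤k d)
  bound : ∀ (h : Vec ℤ k) → h ≢ replicate k 0ℤ → ∀ t → 1 ℕ.≤ t → t ℕ.≤ k → ∀ P → 1 ℕ.≤ P →
    U (2 ℕ.* t) k P h ≤ C · P ^ ((+ t / 1) ℚᵘ.- 1ℚᵘ) ℚᵘ.+ ε
  bound h h≢0 (suc u) _ t≤k P 1≤P =
    ≤·^-intro (((+ suc u / 1) ℚᵘ.- 1ℚᵘ) ℚᵘ.+ ε) numerator denominator (begin
      U (2 * suc u) k P h ^ d           ≤⟨ proj₂ (U^d-≤ k 2≤k d) h h≢0 u t≤k P ⟩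
      C ^ d * P ^ (u * d ℕ.+ 1)         ≤⟨ ℕ.*-monoʳ-≤ (C ^ d) (ℕ.^-monoʳ-≤ P (ℕ.+-monoʳ-≤ (u * d) (s≤s z≤n))) ⟩
      C ^ d * P ^ (u * d ℕ.+ suc a)     ∎)
    where
    open ℕ.≤-Reasoning
    instance
      P≢0 : NonZero P
      P≢0 = ℕ.>-nonZero 1≤P
    numerator : ↥ (((+ suc u / 1) ℚᵘ.- 1ℚᵘ) ℚᵘ.+ ε) ≡ + (u * d ℕ.+ suc a)
    numerator = cong₂ ℤ._+_
      (trans (cong (λ v → + v ℤ.* + d) (ℕ.*-identityʳ u)) (sym (ℤ.pos-* u d)))
      (ℤ.*-identityʳ (+ suc a))
    denominator : ↧ₙ (((+ suc u / 1) ℚᵘ.- 1ℚᵘ) ℚᵘ.+ ε) ≡ d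
    denominator = ℕ.*-identityˡ d
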